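{- For all (possibly open) plain terms $t_0,t_1$ of $\lambda_S$, if $t_0\approx_r t_1$ then $t_0\cong^\circ t_1$ (for closed terms, $t_0\cong t_1$).
   Context: Plain calculus $\lambda_S$: terms $t ::= v \mid t\,t \mid \mathcal{S}k.t \mid \langle t\rangle$, values $v ::= x \mid \lambda x.t$; pure contexts $E ::= \square \mid v\,E \mid E\,t$; evaluation contexts $F ::= \square \mid v\,F \mid F\,t \mid \langle F\rangle$; contexts $C ::= \square \mid \lambda x.C \mid t\,C \mid C\,t \mid \mathcal{S}k.C \mid \langle C\rangle$. Reduction: $F[(\lambda x.t)\,v] \to F[t\{v/x\}]$; $F[\langle E[\mathcal{S}k.t]\rangle] \to F[\langle t\{\lambda x.\langle E[x]\rangle/k\}\rangle]$ ($x\notin\mathrm{fv}(E)$); $F[\langle v\rangle]\to F[v]$. $t\Downarrow t'$: $t\to^*t'$ with $t'$ a normal form (value, or non-value that does not reduce); control-stuck term: $E[\mathcal{S}k.t]$. $t_0\cong t_1$ (closed) iff for every closed $C$, $C[t_0]$ evaluates to a value iff $C[t_1]$ does, and $C[t_0]$ evaluates to a control-stuck term iff $C[t_1]$ does; $t_0\cong^\circ t_1$ iff $t_0\sigma\cong t_1\sigma$ for all substitutions $\sigma$ of closed values for free variables. Extended calculus: context variables $\alpha$; terms add $\alpha\langle t\rangle$ (a new construct where $\alpha$ stands for an unknown delimited context); evaluation contexts add $\alpha\langle F\rangle$; delimited contexts $D ::= \langle E\rangle\mid\alpha\langle E\rangle$ (every extended evaluation context is pure or uniquely $F[D]$). Reduction: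 $\beta$ and $F[\langle v\rangle]\to F[v]$ as before, and $F[D[\mathcal{S}k.t]]\to F[\langle t\{\lambda x.D[x]/k\}\rangle]$ ($x\notin\mathrm{fv}(D)$). Normal forms: values, open-stuck $F[x\,v]$, control-stuck $E[\mathcal{S}k.t]$, context-stuck $F[\alpha\langle v\rangle]$. Extensions of $R$ ($x$, $\alpha$ fresh): $E_0\,R^c\,E_1$ (pure) iff $E_0[x]\,R\,E_1[x]$; $F_0[D_0]\,R^c\,F_1[D_1]$ iff $D_0[x]\,R\,D_1[x]$ and $F_0[x]\,R\,F_1[x]$ (no other pairs); $v_0\,R^v\,v_1$ iff $v_0\,x\,R\,v_1\,x$; $F_0[y\,v_0]\,R^{nf}\,F_1[y\,v_1]$ iff $F_0\,R^c\,F_1$ and $v_0\,R^v\,v_1$; $E_0[\mathcal{S}k.t_0]\,R^{nf}\,E_1[\mathcal{S}k.t_1]$ iff $\langle t_0\{\lambda x.\alpha\langle E_0[x]\rangle/k\}\rangle\,R\,\langle t_1\{\lambda x.\alpha\langle E_1[x]\rangle/k\}\rangle$. A refined normal-form bisimulation is a relation $R$ on open extended terms such that $t_0\,R\,t_1$ implies: $t_0\to t_0'$ gives $t_1\to^*t_1'$ with $t_0'\,R\,t_1'$; $t_0$ value gives $t_1\Downarrow v_1$ with $t_0\,R^v\,v_1$; if $t_0=F_0[\alpha\langle v_0\rangle]$ then $t_1\Downarrow F_1[\alpha\langle v_1\rangle]$ with $F_0[\langle\square\rangle]\,R^c\,F_1[\langle\square\rangle]$ and $v_0\,R^v\,v_1$;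 if $t_0$ is open- or control-stuck then $t_1\Downarrow t_1'$ with $t_0\,R^{nf}\,t_1'$; and symmetrically. $\approx_r$ is the largest refined normal-form bisimulation. -}

module Defs where

-- Shift/reset calculus λS (plain) and its extension with context variables,
-- the refined normal-form bisimilarity ≈r, and contextual equivalence ≅ / ≅°.
-- Term variables are (unscoped) de Bruijn indices; context variables α are
-- names in ℕ (they are never bound).  "Fresh" variables are obtained
-- canonically by shifting all variables of the relevant kind up by one and
-- using index 0.

open import Data.Nat using (ℕ; zero; suc; _<_)
open import Data.Product using (Σ; _×_; _,_; ∃)
open import Data.Sum using (_⊎_)
open import Data.Unit using (⊤)
open import Data.Empty using (⊥)
open import Relation.Nullary using (¬_)
open import Relation.Binary.PropositionalEquality using (_≡_)
open import Relation.Binary.Construct.Closure.ReflexiveTransitive using (Star)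
open import Function using (flip)
open import Function.Bundles using (_⇔_)

mutual
  data Val : Set where
    vvar : ℕ → Val
    vlam : Tm → Val

  data Tm : Set where
    val    : Val → Tm
    app    : Tm → Tm → Tm
    shift  : Tm → Tm          -- S k. t  (binds index 0 in t)
    reset  : Tm → Tm
    creset : ℕ → Tm → Tm

mutual
  PlainV : Val → Set
  PlainV (vvar _) = ⊤
  PlainV (vlam t) = Plain t

  Plain : Tm → Set
  Plain (val v)      = PlainV v
  Plain (app t u)    = Plain t × Plain u
  Plain (shift t)    = Plain t
  Plain (reset t)    = Plain t
  Plain (creset _ _) = ⊥

ext : (ℕ → ℕ) → ℕ → ℕ
ext ρ zero    = zero
ext ρ (suc n) = suc (ρ n)

mutual
  renV : (ℕ → ℕ) → Val → Val
  renV ρ (vvar n) = vvar (ρ n)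
  renV ρ (vlam t) = vlam (ren (ext ρ) t)

  ren : (ℕ → ℕ) → Tm → Tm
  ren ρ (val v)      = val (renV ρ v)
  ren ρ (app t u)    = app (ren ρ t) (ren ρ u)
  ren ρ (shift t)    = shift (ren (ext ρ) t)
  ren ρ (reset t)    = reset (ren ρ t)
  ren ρ (creset α t) = creset α (ren ρ t)

exts : (ℕ → Val) → ℕ → Val
exts σ zero    = vvar zero
exts σ (suc n) = renV suc (σ n)

mutual
  subV : (ℕ → Val) → Val → Val
  subV σ (vvar n) = σ n
  subV σ (vlam t) = vlam (sub (exts σ) t)

  sub : (ℕ → Val) → Tm → Tm
  sub σ (val v)      = val (subV σ v)
  sub σ (app t u)    = app (sub σ t) (sub σ u)
  sub σ (shift t)    = shift (sub (exts σ) t)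
  sub σ (reset t)    = reset (sub σ t)
  sub σ (creset α t) = creset α (sub σ t)

_[_]₀ : Tm → Val → Tm
t [ v ]₀ = sub σ t
  where
  σ : ℕ → Val
  σ zero    = v
  σ (suc n) = vvar n

mutual
  crenV : (ℕ → ℕ) → Val → Val
  crenV ρ (vvar n) = vvar n
  crenV ρ (vlam t) = vlam (cren ρ t)

  cren : (ℕ → ℕ) → Tm → Tm
  cren ρ (val v)      = val (crenV ρ v)
  cren ρ (app t u)    = app (cren ρ t) (cren ρ u)
  cren ρ (shift t)    = shift (cren ρ t)
  cren ρ (reset t)    = reset (cren ρ t)
  cren ρ (creset α t) = creset (ρ α) (cren ρ t)

data PCtx : Set where
  hole : PCtx
  appR : Val → PCtx → PCtx
  appL : PCtx → Tm → PCtx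

data Ctx : Set where
  hole   : Ctx
  appR   : Val → Ctx → Ctx
  appL   : Ctx → Tm → Ctx
  reset  : Ctx → Ctx
  creset : ℕ → Ctx → Ctx

data DCtx : Set where
  dreset  : PCtx → DCtx
  dcreset : ℕ → PCtx → DCtx

plugP : PCtx → Tm → Tm
plugP hole       t = t
plugP (appR v E) t = app (val v) (plugP E t)
plugP (appL E u) t = app (plugP E t) u

plug : Ctx → Tm → Tm
plug hole         t = t
plug (appR v F)   t = app (val v) (plug F t)
plug (appL F u)   t = app (plug F t) u
plug (reset F)    t = reset (plug F t)
plug (creset α F) t = creset α (plug F t)

plugD : DCtx → Tm → Tm
plugD (dreset E)    t = reset (plugP E t)
plugD (dcreset α E) t = creset α (plugP E t)

embP : PCtx → Ctx
embP hole       = hole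
embP (appR v E) = appR v (embP E)
embP (appL E u) = appL (embP E) u

embD : DCtx → Ctx
embD (dreset E)    = reset (embP E)
embD (dcreset α E) = creset α (embP E)

compose : Ctx → Ctx → Ctx
compose hole         G = G
compose (appR v F)   G = appR v (compose F G)
compose (appL F u)   G = appL (compose F G) u
compose (reset F)    G = reset (compose F G)
compose (creset α F) G = creset α (compose F G)

renP : (ℕ → ℕ) → PCtx → PCtx
renP ρ hole       = hole
renP ρ (appR v E) = appR (renV ρ v) (renP ρ E)
renP ρ (appL E u) = appL (renP ρ E) (ren ρ u)

renC : (ℕ → ℕ) → Ctx → Ctx
renC ρ hole         = hole
renC ρ (appR v F)   = appR (renV ρ v) (renC ρ F)
renC ρ (appL F u)   = appL (renC ρ F) (ren ρ u)
renC ρ (reset F)    = reset (renC ρ F)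
renC ρ (creset α F) = creset α (renC ρ F)

renD : (ℕ → ℕ) → DCtx → DCtx
renD ρ (dreset E)    = dreset (renP ρ E)
renD ρ (dcreset α E) = dcreset α (renP ρ E)

crenP : (ℕ → ℕ) → PCtx → PCtx
crenP ρ hole       = hole
crenP ρ (appR v E) = appR (crenV ρ v) (crenP ρ E)
crenP ρ (appL E u) = appL (crenP ρ E) (cren ρ u)

x : Tm
x = val (vvar zero)

plugPx : PCtx → Tm
plugPx E = plugP (renP suc E) x

plugx : Ctx → Tm
plugx F = plug (renC suc F) x

plugDx : DCtx → Tm
plugDx D = plugD (renD suc D) x

data Step : Tm → Tm → Set where
  β      : (F : Ctx) (t : Tm) (v : Val) →
           Step (plug F (app (val (vlam t)) (val v))) (plug F (t [ v ]₀))
  shiftD : (F : Ctx) (D : DCtx) (t : Tm) →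
           Step (plug F (plugD D (shift t)))
                (plug F (reset (t [ vlam (plugDx D) ]₀)))
  resetV : (F : Ctx) (v : Val) →
           Step (plug F (reset (val v))) (plug F (val v))

data PStep : Tm → Tm → Set where
  β      : (F : Ctx) (t : Tm) (v : Val) →
           PStep (plug F (app (val (vlam t)) (val v))) (plug F (t [ v ]₀))
  shiftR : (F : Ctx) (E : PCtx) (t : Tm) →
           PStep (plug F (reset (plugP E (shift t))))
                 (plug F (reset (t [ vlam (reset (plugPx E)) ]₀)))
  resetV : (F : Ctx) (v : Val) →
           PStep (plug F (reset (val v))) (plug F (val v))

_⇓_ : Tm → Tm → Set
t ⇓ t' = Star Step t t' × (∀ u → ¬ Step t' u)

_⇓ₚ_ : Tm → Tm → Set
t ⇓ₚ t' = Star PStep t t' × (∀ u → ¬ PStep t' u)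

ControlStuck : Tm → Set
ControlStuck u = Σ PCtx λ E → Σ Tm λ t → u ≡ plugP E (shift t)

OpenStuck : Tm → Set
OpenStuck u = Σ Ctx λ F → Σ ℕ λ y → Σ Val λ v → u ≡ plug F (app (val (vvar y)) (val v))

mutual
  WSV : ℕ → Val → Set
  WSV n (vvar m) = m < n
  WSV n (vlam t) = WS (suc n) t

  WS : ℕ → Tm → Set
  WS n (val v)      = WSV n v
  WS n (app t u)    = WS n t × WS n u
  WS n (shift t)    = WS (suc n) t
  WS n (reset t)    = WS n t
  WS n (creset _ t) = WS n t

Closed : Tm → Set
Closed = WS 0

data GCtx : Set where
  ghole  : GCtx
  glam   : GCtx → GCtx
  gappR  : Tm → GCtx → GCtx
  gappL  : GCtx → Tm → GCtx
  gshift : GCtx → GCtx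
  greset : GCtx → GCtx

gplug : GCtx → Tm → Tm
gplug ghole      t = t
gplug (glam C)   t = val (vlam (gplug C t))
gplug (gappR u C) t = app u (gplug C t)
gplug (gappL C u) t = app (gplug C t) u
gplug (gshift C) t = shift (gplug C t)
gplug (greset C) t = reset (gplug C t)

WSC : ℕ → GCtx → Set
WSC n ghole       = ⊤
WSC n (glam C)    = WSC (suc n) C
WSC n (gappR u C) = (WS n u × Plain u) × WSC n C
WSC n (gappL C u) = WSC n C × (WS n u × Plain u)
WSC n (gshift C)  = WSC (suc n) C
WSC n (greset C)  = WSC n C

ClosedCtx : GCtx → Set
ClosedCtx = WSC 0

EvalsToValue : Tm → Set
EvalsToValue t = Σ Val λ v → t ⇓ₚ val v

EvalsToStuck : Tm → Set
EvalsToStuck t = Σ Tm λ u → t ⇓ₚ u × ControlStuck u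

-- t₀ ≅ t₁  (meant for closed terms)
_≅_ : Tm → Tm → Set
t₀ ≅ t₁ = (C : GCtx) → ClosedCtx C →
            (EvalsToValue (gplug C t₀) ⇔ EvalsToValue (gplug C t₁))
          × (EvalsToStuck (gplug C t₀) ⇔ EvalsToStuck (gplug C t₁))

_≅°_ : Tm → Tm → Set
t₀ ≅° t₁ = (σ : ℕ → Val) → (∀ n → WSV 0 (σ n) × PlainV (σ n)) →
           sub σ t₀ ≅ sub σ t₁

Rel : Set₁
Rel = Tm → Tm → Set

RV : Rel → Val → Val → Set
RV R v₀ v₁ = R (app (val (renV suc v₀)) x) (app (val (renV suc v₁)) x)

RC : Rel → Ctx → Ctx → Set
RC R G₀ G₁ =
    (Σ PCtx λ E₀ → Σ PCtx λ E₁ →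
       G₀ ≡ embP E₀ × G₁ ≡ embP E₁ × R (plugPx E₀) (plugPx E₁))
  ⊎ (Σ Ctx λ F₀ → Σ DCtx λ D₀ → Σ Ctx λ F₁ → Σ DCtx λ D₁ →
       G₀ ≡ compose F₀ (embD D₀) × G₁ ≡ compose F₁ (embD D₁) ×
       R (plugDx D₀) (plugDx D₁) × R (plugx F₀) (plugx F₁))

-- λx.α⟨E[x]⟩ with α fresh (α = 0 after shifting all context variables)
kont : PCtx → Val
kont E = vlam (creset zero (plugPx (crenP suc E)))

RNF : Rel → Tm → Tm → Set
RNF R u₀ u₁ =
    (Σ Ctx λ F₀ → Σ Ctx λ F₁ → Σ ℕ λ y → Σ Val λ v₀ → Σ Val λ v₁ →
       u₀ ≡ plug F₀ (app (val (vvar y)) (val v₀)) ×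
       u₁ ≡ plug F₁ (app (val (vvar y)) (val v₁)) ×
       RC R F₀ F₁ × RV R v₀ v₁)
  ⊎ (Σ PCtx λ E₀ → Σ Tm λ t₀ → Σ PCtx λ E₁ → Σ Tm λ t₁ →
       u₀ ≡ plugP E₀ (shift t₀) × u₁ ≡ plugP E₁ (shift t₁) ×
       R (reset (cren suc t₀ [ kont E₀ ]₀)) (reset (cren suc t₁ [ kont E₁ ]₀)))

Progress : Rel → Tm → Tm → Set
Progress R t₀ t₁ =
    (∀ t₀' → Step t₀ t₀' → Σ Tm λ t₁' → Star Step t₁ t₁' × R t₀' t₁')
  × (∀ v₀ → t₀ ≡ val v₀ → Σ Val λ v₁ → t₁ ⇓ val v₁ × RV R v₀ v₁)
  × (∀ F₀ α v₀ → t₀ ≡ plug F₀ (creset α (val v₀)) →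
       Σ Ctx λ F₁ → Σ Val λ v₁ →
         t₁ ⇓ plug F₁ (creset α (val v₁)) ×
         RC R (compose F₀ (reset hole)) (compose F₁ (reset hole)) ×
         RV R v₀ v₁)
  × (OpenStuck t₀ ⊎ ControlStuck t₀ → Σ Tm λ t₁' → t₁ ⇓ t₁' × RNF R t₀ t₁')

IsRefinedNFBisim : Rel → Set
IsRefinedNFBisim R = ∀ t₀ t₁ → R t₀ t₁ → Progress R t₀ t₁ × Progress (flip R) t₁ t₀

_≈r_ : Tm → Tm → Set₁
t₀ ≈r t₁ = Σ Rel λ R → IsRefinedNFBisim R × R t₀ t₁

{-# OPTIONS --safe #-}
module Submission where

open import Defs
open import Data.Bool using (Bool; true; false)
open import Data.Empty using (⊥; ⊥-elim)
import Data.Maybe as Maybe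
open import Data.Maybe using (Maybe; just; nothing; maybe)
open import Data.Nat using (ℕ; zero; suc; _+_; _<_; z≤n; s≤s; z<s; s<s; s<s⁻¹)
open import Data.Nat.Properties using (≤-refl; <-≤-trans; +-monoˡ-<)
open import Data.Product using (Σ; _×_; _,_; proj₁; proj₂)
open import Data.Sum using (_⊎_; inj₁; inj₂)
open import Data.Unit using (⊤; tt)
open import Function using (flip)
open import Function.Bundles using (_⇔_; mk⇔)
open import Relation.Binary.Construct.Closure.ReflexiveTransitive using (Star; ε; _◅_; _◅◅_; gmap)
open import Relation.Binary.PropositionalEquality using (_≡_; refl; sym; trans; cong; cong₂; subst; subst₂; module ≡-Reasoning)
open import Relation.Nullary using (¬_)

-- Fix a bisimulation R and close it under congruence and under substitution of
-- related values for variables and of related delimited contexts for context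
-- variables.  Programs are pairs of related stacks of context fragments around
-- related terms.  If the left program reaches a value or a control-stuck term
-- in n steps, the right one reaches a result of the same kind (in any number of
-- steps): by induction on n, and for fixed n by recursion on how the focus, the function being called and the stack were
-- built.  A stuck R-term F[y v] or F[α⟨v⟩] hands control to the value or context
-- substituted for y or α, leaving F (related by Rᶜ) on the stack; a control-stuck
-- R-term binds its fresh context variable to the captured part of the stack.

-- Composition of contexts.

composeP : PCtx → PCtx → PCtx
composeP hole       P = P
composeP (appR v E) P = appR v (composeP E P)
composeP (appL E u) P = appL (composeP E P) u

composeD : DCtx → PCtx → DCtx
composeD (dreset E)    P = dreset (composeP E P)
composeD (dcreset α E) P = dcreset α (composeP E P)

plugP-compose : ∀ E P t → plugP (composeP E P) t ≡ plugP E (plugP P t)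
plugP-compose hole       P t = refl
plugP-compose (appR v E) P t = cong (app (val v)) (plugP-compose E P t)
plugP-compose (appL E u) P t = cong (λ s → app s u) (plugP-compose E P t)

plugD-compose : ∀ D P t → plugD (composeD D P) t ≡ plugD D (plugP P t)
plugD-compose (dreset E)    P t = cong reset (plugP-compose E P t)
plugD-compose (dcreset α E) P t = cong (creset α) (plugP-compose E P t)

plug-compose : ∀ F G t → plug (compose F G) t ≡ plug F (plug G t)
plug-compose hole         G t = refl
plug-compose (appR v F)   G t = cong (app (val v)) (plug-compose F G t)
plug-compose (appL F u)   G t = cong (λ s → app s u) (plug-compose F G t)
plug-compose (reset F)    G t = cong reset (plug-compose F G t)
plug-compose (creset α F) G t = cong (creset α) (plug-compose F G t)

plug-embP : ∀ E t → plug (embP E) t ≡ plugP E t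
plug-embP hole       t = refl
plug-embP (appR v E) t = cong (app (val v)) (plug-embP E t)
plug-embP (appL E u) t = cong (λ s → app s u) (plug-embP E t)

plug-embD : ∀ D t → plug (embD D) t ≡ plugD D t
plug-embD (dreset E)    t = cong reset (plug-embP E t)
plug-embD (dcreset α E) t = cong (creset α) (plug-embP E t)

plug-composeD : ∀ F D t → plug (compose F (embD D)) t ≡ plug F (plugD D t)
plug-composeD F D t = trans (plug-compose F (embD D) t) (cong (plug F) (plug-embD D t))

-- Simultaneous substitution of values for term variables and of delimited
-- contexts for context variables: α⟨t⟩ becomes θ(α)[t].

-- Binders bind term variables only, so passing under one weakens the substituted contexts but adds
-- no entry for a context variable.
extd : (ℕ → DCtx) → ℕ → DCtx
extd θ α = renD suc (θ α)

mutual
  esubV : (ℕ → Val) → (ℕ → DCtx) → Val → Val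
  esubV σ θ (vvar n) = σ n
  esubV σ θ (vlam t) = vlam (esub (exts σ) (extd θ) t)

  esub : (ℕ → Val) → (ℕ → DCtx) → Tm → Tm
  esub σ θ (val v)      = val (esubV σ θ v)
  esub σ θ (app t u)    = app (esub σ θ t) (esub σ θ u)
  esub σ θ (shift t)    = shift (esub (exts σ) (extd θ) t)
  esub σ θ (reset t)    = reset (esub σ θ t)
  esub σ θ (creset α t) = plugD (θ α) (esub σ θ t)

esubP : (ℕ → Val) → (ℕ → DCtx) → PCtx → PCtx
esubP σ θ hole       = hole
esubP σ θ (appR v E) = appR (esubV σ θ v) (esubP σ θ E)
esubP σ θ (appL E u) = appL (esubP σ θ E) (esub σ θ u)

esubD : (ℕ → Val) → (ℕ → DCtx) → DCtx → DCtx
esubD σ θ (dreset E)    = dreset (esubP σ θ E)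
esubD σ θ (dcreset α E) = composeD (θ α) (esubP σ θ E)

esubC : (ℕ → Val) → (ℕ → DCtx) → Ctx → Ctx
esubC σ θ hole         = hole
esubC σ θ (appR v F)   = appR (esubV σ θ v) (esubC σ θ F)
esubC σ θ (appL F u)   = appL (esubC σ θ F) (esub σ θ u)
esubC σ θ (reset F)    = reset (esubC σ θ F)
esubC σ θ (creset α F) = compose (embD (θ α)) (esubC σ θ F)

idθ : ℕ → DCtx
idθ α = dcreset α hole

_•_ : {A : Set} → A → (ℕ → A) → ℕ → A
(a • f) zero    = a
(a • f) (suc n) = f n

-- Commutation and fusion laws for renaming and substitution.

ren-plugP : ∀ ρ E t → ren ρ (plugP E t) ≡ plugP (renP ρ E) (ren ρ t)
ren-plugP ρ hole       t = refl
ren-plugP ρ (appR v E) t = cong (app _) (ren-plugP ρ E t)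
ren-plugP ρ (appL E u) t = cong (λ s → app s _) (ren-plugP ρ E t)

ren-plugD : ∀ ρ D t → ren ρ (plugD D t) ≡ plugD (renD ρ D) (ren ρ t)
ren-plugD ρ (dreset E)    t = cong reset (ren-plugP ρ E t)
ren-plugD ρ (dcreset α E) t = cong (creset α) (ren-plugP ρ E t)

renP-compose : ∀ ρ E P → renP ρ (composeP E P) ≡ composeP (renP ρ E) (renP ρ P)
renP-compose ρ hole       P = refl
renP-compose ρ (appR v E) P = cong (appR _) (renP-compose ρ E P)
renP-compose ρ (appL E u) P = cong (λ E → appL E _) (renP-compose ρ E P)

renD-compose : ∀ ρ D P → renD ρ (composeD D P) ≡ composeD (renD ρ D) (renP ρ P)
renD-compose ρ (dreset E)    P = cong dreset (renP-compose ρ E P)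
renD-compose ρ (dcreset α E) P = cong (dcreset α) (renP-compose ρ E P)

esub-plugP : ∀ σ θ E t → esub σ θ (plugP E t) ≡ plugP (esubP σ θ E) (esub σ θ t)
esub-plugP σ θ hole       t = refl
esub-plugP σ θ (appR v E) t = cong (app _) (esub-plugP σ θ E t)
esub-plugP σ θ (appL E u) t = cong (λ s → app s _) (esub-plugP σ θ E t)

esub-plugD : ∀ σ θ D t → esub σ θ (plugD D t) ≡ plugD (esubD σ θ D) (esub σ θ t)
esub-plugD σ θ (dreset E)    t = cong reset (esub-plugP σ θ E t)
esub-plugD σ θ (dcreset α E) t =
  trans (cong (plugD (θ α)) (esub-plugP σ θ E t)) (sym (plugD-compose (θ α) _ _))

esub-plug : ∀ σ θ F t → esub σ θ (plug F t) ≡ plug (esubC σ θ F) (esub σ θ t)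
esub-plug σ θ hole         t = refl
esub-plug σ θ (appR v F)   t = cong (app _) (esub-plug σ θ F t)
esub-plug σ θ (appL F u)   t = cong (λ s → app s _) (esub-plug σ θ F t)
esub-plug σ θ (reset F)    t = cong reset (esub-plug σ θ F t)
esub-plug σ θ (creset α F) t =
  trans (cong (plugD (θ α)) (esub-plug σ θ F t))
        (sym (trans (plug-compose (embD (θ α)) (esubC σ θ F) _) (plug-embD (θ α) _)))

-- The fusion laws take a pointwise description of the composite substitution,
-- which makes function extensionality unnecessary.

ext-fusion : ∀ {ρ₁ ρ₂ ρ₃} → (∀ n → ρ₂ (ρ₁ n) ≡ ρ₃ n) → ∀ n → ext ρ₂ (ext ρ₁ n) ≡ ext ρ₃ n
ext-fusion h zero    = refl
ext-fusion h (suc n) = cong suc (h n)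

mutual
  renV-renV : ∀ {ρ₁ ρ₂ ρ₃} → (∀ n → ρ₂ (ρ₁ n) ≡ ρ₃ n) → ∀ v → renV ρ₂ (renV ρ₁ v) ≡ renV ρ₃ v
  renV-renV h (vvar n) = cong vvar (h n)
  renV-renV h (vlam t) = cong vlam (ren-ren (ext-fusion h) t)

  ren-ren : ∀ {ρ₁ ρ₂ ρ₃} → (∀ n → ρ₂ (ρ₁ n) ≡ ρ₃ n) → ∀ t → ren ρ₂ (ren ρ₁ t) ≡ ren ρ₃ t
  ren-ren h (val v)      = cong val (renV-renV h v)
  ren-ren h (app t u)    = cong₂ app (ren-ren h t) (ren-ren h u)
  ren-ren h (shift t)    = cong shift (ren-ren (ext-fusion h) t)
  ren-ren h (reset t)    = cong reset (ren-ren h t)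
  ren-ren h (creset α t) = cong (creset α) (ren-ren h t)

renP-renP : ∀ {ρ₁ ρ₂ ρ₃} → (∀ n → ρ₂ (ρ₁ n) ≡ ρ₃ n) → ∀ E → renP ρ₂ (renP ρ₁ E) ≡ renP ρ₃ E
renP-renP h hole       = refl
renP-renP h (appR v E) = cong₂ appR (renV-renV h v) (renP-renP h E)
renP-renP h (appL E u) = cong₂ appL (renP-renP h E) (ren-ren h u)

renD-renD : ∀ {ρ₁ ρ₂ ρ₃} → (∀ n → ρ₂ (ρ₁ n) ≡ ρ₃ n) → ∀ D → renD ρ₂ (renD ρ₁ D) ≡ renD ρ₃ D
renD-renD h (dreset E)    = cong dreset (renP-renP h E)
renD-renD h (dcreset α E) = cong (dcreset α) (renP-renP h E)

renV-comm : ∀ ρ v → renV (ext ρ) (renV suc v) ≡ renV suc (renV ρ v)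
renV-comm ρ v = trans (renV-renV (λ _ → refl) v) (sym (renV-renV (λ _ → refl) v))

renD-comm : ∀ ρ D → renD (ext ρ) (renD suc D) ≡ renD suc (renD ρ D)
renD-comm ρ D = trans (renD-renD (λ _ → refl) D) (sym (renD-renD (λ _ → refl) D))

exts-ren : ∀ {σ ρ τ} → (∀ n → σ (ρ n) ≡ τ n) → ∀ n → exts σ (ext ρ n) ≡ exts τ n
exts-ren h zero    = refl
exts-ren h (suc n) = cong (renV suc) (h n)

mutual
  esubV-ren : ∀ {σ τ θ ψ ρ} → (∀ n → σ (ρ n) ≡ τ n) → (∀ α → θ α ≡ ψ α) →
              ∀ v → esubV σ θ (renV ρ v) ≡ esubV τ ψ v
  esubV-ren h k (vvar n) = h n
  esubV-ren h k (vlam t) = cong vlam (esub-ren (exts-ren h) (λ α → cong (renD suc) (k α)) t)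

  esub-ren : ∀ {σ τ θ ψ ρ} → (∀ n → σ (ρ n) ≡ τ n) → (∀ α → θ α ≡ ψ α) →
             ∀ t → esub σ θ (ren ρ t) ≡ esub τ ψ t
  esub-ren h k (val v)      = cong val (esubV-ren h k v)
  esub-ren h k (app t u)    = cong₂ app (esub-ren h k t) (esub-ren h k u)
  esub-ren h k (shift t)    = cong shift (esub-ren (exts-ren h) (λ α → cong (renD suc) (k α)) t)
  esub-ren h k (reset t)    = cong reset (esub-ren h k t)
  esub-ren h k (creset α t) = cong₂ plugD (k α) (esub-ren h k t)

esubP-ren : ∀ {σ τ θ ψ ρ} → (∀ n → σ (ρ n) ≡ τ n) → (∀ α → θ α ≡ ψ α) →
            ∀ E → esubP σ θ (renP ρ E) ≡ esubP τ ψ E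
esubP-ren h k hole       = refl
esubP-ren h k (appR v E) = cong₂ appR (esubV-ren h k v) (esubP-ren h k E)
esubP-ren h k (appL E u) = cong₂ appL (esubP-ren h k E) (esub-ren h k u)

esubD-ren : ∀ {σ τ θ ψ ρ} → (∀ n → σ (ρ n) ≡ τ n) → (∀ α → θ α ≡ ψ α) →
            ∀ D → esubD σ θ (renD ρ D) ≡ esubD τ ψ D
esubD-ren h k (dreset E)    = cong dreset (esubP-ren h k E)
esubD-ren h k (dcreset α E) = cong₂ composeD (k α) (esubP-ren h k E)

esubC-ren : ∀ {σ τ θ ψ ρ} → (∀ n → σ (ρ n) ≡ τ n) → (∀ α → θ α ≡ ψ α) →
            ∀ F → esubC σ θ (renC ρ F) ≡ esubC τ ψ F
esubC-ren h k hole         = refl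
esubC-ren h k (appR v F)   = cong₂ appR (esubV-ren h k v) (esubC-ren h k F)
esubC-ren h k (appL F u)   = cong₂ appL (esubC-ren h k F) (esub-ren h k u)
esubC-ren h k (reset F)    = cong reset (esubC-ren h k F)
esubC-ren h k (creset α F) = cong₂ compose (cong embD (k α)) (esubC-ren h k F)

exts-cren : ∀ {σ τ} → (∀ n → σ n ≡ τ n) → ∀ n → exts σ n ≡ exts τ n
exts-cren h zero    = refl
exts-cren h (suc n) = cong (renV suc) (h n)

mutual
  esubV-cren : ∀ {σ τ θ ψ ρ} → (∀ n → σ n ≡ τ n) → (∀ α → θ (ρ α) ≡ ψ α) →
               ∀ v → esubV σ θ (crenV ρ v) ≡ esubV τ ψ v
  esubV-cren h k (vvar n) = h n
  esubV-cren h k (vlam t) = cong vlam (esub-cren (exts-cren h) (λ α → cong (renD suc) (k α)) t)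

  esub-cren : ∀ {σ τ θ ψ ρ} → (∀ n → σ n ≡ τ n) → (∀ α → θ (ρ α) ≡ ψ α) →
              ∀ t → esub σ θ (cren ρ t) ≡ esub τ ψ t
  esub-cren h k (val v)      = cong val (esubV-cren h k v)
  esub-cren h k (app t u)    = cong₂ app (esub-cren h k t) (esub-cren h k u)
  esub-cren h k (shift t)    = cong shift (esub-cren (exts-cren h) (λ α → cong (renD suc) (k α)) t)
  esub-cren h k (reset t)    = cong reset (esub-cren h k t)
  esub-cren h k (creset α t) = cong₂ plugD (k α) (esub-cren h k t)

esubP-cren : ∀ {σ τ θ ψ ρ} → (∀ n → σ n ≡ τ n) → (∀ α → θ (ρ α) ≡ ψ α) →
             ∀ E → esubP σ θ (crenP ρ E) ≡ esubP τ ψ E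
esubP-cren h k hole       = refl
esubP-cren h k (appR v E) = cong₂ appR (esubV-cren h k v) (esubP-cren h k E)
esubP-cren h k (appL E u) = cong₂ appL (esubP-cren h k E) (esub-cren h k u)

ren-exts : ∀ {σ τ ρ} → (∀ n → renV ρ (σ n) ≡ τ n) → ∀ n → renV (ext ρ) (exts σ n) ≡ exts τ n
ren-exts h zero    = refl
ren-exts {σ} {ρ = ρ} h (suc n) = trans (renV-comm ρ (σ n)) (cong (renV suc) (h n))

ren-extd : ∀ {θ ψ ρ} → (∀ α → renD ρ (θ α) ≡ ψ α) → ∀ α → renD (ext ρ) (extd θ α) ≡ extd ψ α
ren-extd {θ} {ρ = ρ} k α = trans (renD-comm ρ (θ α)) (cong (renD suc) (k α))

mutual
  renV-esub : ∀ {σ τ θ ψ ρ} → (∀ n → renV ρ (σ n) ≡ τ n) → (∀ α → renD ρ (θ α) ≡ ψ α) →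
              ∀ v → renV ρ (esubV σ θ v) ≡ esubV τ ψ v
  renV-esub h k (vvar n) = h n
  renV-esub h k (vlam t) = cong vlam (ren-esub (ren-exts h) (ren-extd k) t)

  ren-esub : ∀ {σ τ θ ψ ρ} → (∀ n → renV ρ (σ n) ≡ τ n) → (∀ α → renD ρ (θ α) ≡ ψ α) →
             ∀ t → ren ρ (esub σ θ t) ≡ esub τ ψ t
  ren-esub h k (val v)      = cong val (renV-esub h k v)
  ren-esub h k (app t u)    = cong₂ app (ren-esub h k t) (ren-esub h k u)
  ren-esub h k (shift t)    = cong shift (ren-esub (ren-exts h) (ren-extd k) t)
  ren-esub h k (reset t)    = cong reset (ren-esub h k t)
  ren-esub h k (creset α t) = trans (ren-plugD _ _ _) (cong₂ plugD (k α) (ren-esub h k t))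

renP-esub : ∀ {σ τ θ ψ ρ} → (∀ n → renV ρ (σ n) ≡ τ n) → (∀ α → renD ρ (θ α) ≡ ψ α) →
            ∀ E → renP ρ (esubP σ θ E) ≡ esubP τ ψ E
renP-esub h k hole       = refl
renP-esub h k (appR v E) = cong₂ appR (renV-esub h k v) (renP-esub h k E)
renP-esub h k (appL E u) = cong₂ appL (renP-esub h k E) (ren-esub h k u)

renD-esub : ∀ {σ τ θ ψ ρ} → (∀ n → renV ρ (σ n) ≡ τ n) → (∀ α → renD ρ (θ α) ≡ ψ α) →
            ∀ D → renD ρ (esubD σ θ D) ≡ esubD τ ψ D
renD-esub h k (dreset E)    = cong dreset (renP-esub h k E)
renD-esub h k (dcreset α E) = trans (renD-compose _ _ _) (cong₂ composeD (k α) (renP-esub h k E))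

esubV-suc : ∀ σ θ v → esubV (exts σ) (extd θ) (renV suc v) ≡ renV suc (esubV σ θ v)
esubV-suc σ θ v = trans (esubV-ren (λ _ → refl) (λ _ → refl) v) (sym (renV-esub (λ _ → refl) (λ _ → refl) v))

esubP-suc : ∀ σ θ E → esubP (exts σ) (extd θ) (renP suc E) ≡ renP suc (esubP σ θ E)
esubP-suc σ θ E = trans (esubP-ren (λ _ → refl) (λ _ → refl) E) (sym (renP-esub (λ _ → refl) (λ _ → refl) E))

esubD-suc : ∀ σ θ D → esubD (exts σ) (extd θ) (renD suc D) ≡ renD suc (esubD σ θ D)
esubD-suc σ θ D = trans (esubD-ren (λ _ → refl) (λ _ → refl) D) (sym (renD-esub (λ _ → refl) (λ _ → refl) D))

exts-esub : ∀ {σ₁ σ₂ θ₂ τ} → (∀ n → esubV σ₂ θ₂ (σ₁ n) ≡ τ n) →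
            ∀ n → esubV (exts σ₂) (extd θ₂) (exts σ₁ n) ≡ exts τ n
exts-esub h zero    = refl
exts-esub {σ₁} {σ₂} {θ₂} h (suc n) = trans (esubV-suc σ₂ θ₂ (σ₁ n)) (cong (renV suc) (h n))

extd-esub : ∀ {θ₁ σ₂ θ₂ ψ} → (∀ α → esubD σ₂ θ₂ (θ₁ α) ≡ ψ α) →
            ∀ α → esubD (exts σ₂) (extd θ₂) (extd θ₁ α) ≡ extd ψ α
extd-esub {θ₁} {σ₂} {θ₂} k α = trans (esubD-suc σ₂ θ₂ (θ₁ α)) (cong (renD suc) (k α))

mutual
  esubV-esub : ∀ {σ₁ θ₁ σ₂ θ₂ τ ψ} → (∀ n → esubV σ₂ θ₂ (σ₁ n) ≡ τ n) →
               (∀ α → esubD σ₂ θ₂ (θ₁ α) ≡ ψ α) → ∀ v → esubV σ₂ θ₂ (esubV σ₁ θ₁ v) ≡ esubV τ ψ v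
  esubV-esub h k (vvar n) = h n
  esubV-esub {θ₁ = θ₁} h k (vlam t) = cong vlam (esub-esub (exts-esub h) (extd-esub {θ₁} k) t)

  esub-esub : ∀ {σ₁ θ₁ σ₂ θ₂ τ ψ} → (∀ n → esubV σ₂ θ₂ (σ₁ n) ≡ τ n) →
              (∀ α → esubD σ₂ θ₂ (θ₁ α) ≡ ψ α) → ∀ t → esub σ₂ θ₂ (esub σ₁ θ₁ t) ≡ esub τ ψ t
  esub-esub h k (val v)      = cong val (esubV-esub h k v)
  esub-esub h k (app t u)    = cong₂ app (esub-esub h k t) (esub-esub h k u)
  esub-esub {θ₁ = θ₁} h k (shift t) = cong shift (esub-esub (exts-esub h) (extd-esub {θ₁} k) t)
  esub-esub h k (reset t)    = cong reset (esub-esub h k t)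
  esub-esub {θ₁ = θ₁} h k (creset α t) =
    trans (esub-plugD _ _ (θ₁ α) _) (cong₂ plugD (k α) (esub-esub h k t))

exts-id : ∀ {σ} → (∀ n → σ n ≡ vvar n) → ∀ n → exts σ n ≡ vvar n
exts-id h zero    = refl
exts-id h (suc n) = cong (renV suc) (h n)

mutual
  esubV-id : ∀ {σ} → (∀ n → σ n ≡ vvar n) → ∀ v → esubV σ idθ v ≡ v
  esubV-id h (vvar n) = h n
  esubV-id h (vlam t) = cong vlam (esub-id (exts-id h) t)

  esub-id : ∀ {σ} → (∀ n → σ n ≡ vvar n) → ∀ t → esub σ idθ t ≡ t
  esub-id h (val v)      = cong val (esubV-id h v)
  esub-id h (app t u)    = cong₂ app (esub-id h t) (esub-id h u)
  esub-id h (shift t)    = cong shift (esub-id (exts-id h) t)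
  esub-id h (reset t)    = cong reset (esub-id h t)
  esub-id h (creset α t) = cong (creset α) (esub-id h t)

esubP-id : ∀ {σ} → (∀ n → σ n ≡ vvar n) → ∀ E → esubP σ idθ E ≡ E
esubP-id h hole       = refl
esubP-id h (appR v E) = cong₂ appR (esubV-id h v) (esubP-id h E)
esubP-id h (appL E u) = cong₂ appL (esubP-id h E) (esub-id h u)

esubD-id : ∀ {σ} → (∀ n → σ n ≡ vvar n) → ∀ D → esubD σ idθ D ≡ D
esubD-id h (dreset E)    = cong dreset (esubP-id h E)
esubD-id h (dcreset α E) = cong (dcreset α) (esubP-id h E)

mutual
  subV-esubV : ∀ σ v → subV σ v ≡ esubV σ idθ v
  subV-esubV σ (vvar n) = refl
  subV-esubV σ (vlam t) = cong vlam (sub-esub (exts σ) t)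

  sub-esub : ∀ σ t → sub σ t ≡ esub σ idθ t
  sub-esub σ (val v)      = cong val (subV-esubV σ v)
  sub-esub σ (app t u)    = cong₂ app (sub-esub σ t) (sub-esub σ u)
  sub-esub σ (shift t)    = cong shift (sub-esub (exts σ) t)
  sub-esub σ (reset t)    = cong reset (sub-esub σ t)
  sub-esub σ (creset α t) = cong (creset α) (sub-esub σ t)

-- Lets a β-step of a closure be read as an extension of its environment: weakening the old entries
-- and then substituting for index 0 cancels out.
esub-[]₀ : ∀ σ θ t v → esub (exts σ) (extd θ) t [ v ]₀ ≡ esub (v • σ) θ t
esub-[]₀ σ θ t v =
  trans (sub-esub _ _)
        (esub-esub (λ { zero → refl
                      ; (suc n) → trans (esubV-ren (λ _ → refl) (λ _ → refl) (σ n)) (esubV-id (λ _ → refl) (σ n)) })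
                   (λ α → trans (esubD-ren (λ _ → refl) (λ _ → refl) (θ α)) (esubD-id (λ _ → refl) (θ α))) t)

composeP-hole : ∀ E → composeP E hole ≡ E
composeP-hole hole       = refl
composeP-hole (appR v E) = cong (appR v) (composeP-hole E)
composeP-hole (appL E u) = cong (λ E → appL E u) (composeP-hole E)

composeD-hole : ∀ D → composeD D hole ≡ D
composeD-hole (dreset E)    = cong dreset (composeP-hole E)
composeD-hole (dcreset α E) = cong (dcreset α) (composeP-hole E)

[]₀-esub : ∀ σ θ t v → esub σ θ (t [ v ]₀) ≡ esub (esubV σ θ v • σ) θ t
[]₀-esub σ θ t v =
  trans (cong (esub σ θ) (sub-esub _ t))
        (esub-esub (λ { zero → refl ; (suc n) → refl }) (λ α → composeD-hole (θ α)) t)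

esub-comm-[]₀ : ∀ σ θ t v → esub σ θ (t [ v ]₀) ≡ esub (exts σ) (extd θ) t [ esubV σ θ v ]₀
esub-comm-[]₀ σ θ t v = trans ([]₀-esub σ θ t v) (sym (esub-[]₀ σ θ t _))

esub-plugDx : ∀ σ θ D → esub (exts σ) (extd θ) (plugDx D) ≡ plugDx (esubD σ θ D)
esub-plugDx σ θ D = trans (esub-plugD _ _ (renD suc D) x) (cong (λ D → plugD D x) (esubD-suc σ θ D))

plugDx-[]₀ : ∀ D v → plugDx D [ v ]₀ ≡ plugD D (val v)
plugDx-[]₀ D v = trans (sub-esub _ (plugDx D)) (trans (esub-plugD _ _ (renD suc D) x)
  (cong (λ D → plugD D (val v)) (trans (esubD-ren (λ _ → refl) (λ _ → refl) D) (esubD-id (λ _ → refl) D))))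

-- The relation `RC` compares contexts through a fresh variable in the hole. Binding that variable
-- to `v` turns such a test term into the instantiated context around `v`; the three laws that
-- follow do the same for the other tests.
esub-x-P : ∀ σ θ E v → esub (v • σ) θ (plugPx E) ≡ plugP (esubP σ θ E) (val v)
esub-x-P σ θ E v = trans (esub-plugP _ _ (renP suc E) x) (cong (λ E → plugP E (val v)) (esubP-ren (λ _ → refl) (λ _ → refl) E))

esub-x-D : ∀ σ θ D v → esub (v • σ) θ (plugDx D) ≡ plugD (esubD σ θ D) (val v)
esub-x-D σ θ D v = trans (esub-plugD _ _ (renD suc D) x) (cong (λ D → plugD D (val v)) (esubD-ren (λ _ → refl) (λ _ → refl) D))

esub-x-C : ∀ σ θ F v → esub (v • σ) θ (plugx F) ≡ plug (esubC σ θ F) (val v)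
esub-x-C σ θ F v = trans (esub-plug _ _ (renC suc F) x) (cong (λ F → plug F (val v)) (esubC-ren (λ _ → refl) (λ _ → refl) F))

esub-x-V : ∀ σ θ u v → esub (v • σ) θ (app (val (renV suc u)) x) ≡ app (val (esubV σ θ u)) (val v)
esub-x-V σ θ u v = cong (λ u → app (val u) (val v)) (esubV-ren (λ _ → refl) (λ _ → refl) u)

-- Instantiating the fresh context variable of a control-stuck pair by D
-- yields exactly the term obtained by capturing D around E.
esub-kont : ∀ σ θ D E t →
  esub σ (D • θ) (cren suc t [ kont E ]₀)
    ≡ esub (exts σ) (extd θ) t [ vlam (plugDx (composeD D (esubP σ θ E))) ]₀
esub-kont σ θ D E t = begin
  esub σ (D • θ) (cren suc t [ kont E ]₀)
    ≡⟨ []₀-esub σ (D • θ) (cren suc t) (kont E) ⟩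
  esub (esubV σ (D • θ) (kont E) • σ) (D • θ) (cren suc t)
    ≡⟨ esub-cren (λ { zero → cong vlam eq ; (suc n) → refl }) (λ _ → refl) t ⟩
  esub (vlam (plugDx (composeD D (esubP σ θ E))) • σ) θ t
    ≡⟨ sym (esub-[]₀ σ θ t _) ⟩
  esub (exts σ) (extd θ) t [ vlam (plugDx (composeD D (esubP σ θ E))) ]₀ ∎
  where
  open ≡-Reasoning
  -- The fresh context variable 0 is sent to `D`, while `crenP suc` makes every context variable of
  -- `E` look up the tail `θ`.
  eq : plugD (renD suc D) (esub (exts σ) (extd (D • θ)) (plugPx (crenP suc E)))
         ≡ plugDx (composeD D (esubP σ θ E))
  eq = begin
    plugD (renD suc D) (esub (exts σ) (extd (D • θ)) (plugPx (crenP suc E)))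
      ≡⟨ cong (plugD (renD suc D)) (esub-plugP _ _ (renP suc (crenP suc E)) x) ⟩
    plugD (renD suc D) (plugP (esubP (exts σ) (extd (D • θ)) (renP suc (crenP suc E))) x)
      ≡⟨ cong (λ P → plugD (renD suc D) (plugP P x))
           (trans (esubP-suc σ (D • θ) (crenP suc E))
                  (cong (renP suc) (esubP-cren (λ _ → refl) (λ _ → refl) E))) ⟩
    plugD (renD suc D) (plugP (renP suc (esubP σ θ E)) x)
      ≡⟨ sym (plugD-compose (renD suc D) _ x) ⟩
    plugD (composeD (renD suc D) (renP suc (esubP σ θ E))) x
      ≡⟨ cong (λ D → plugD D x) (sym (renD-compose suc D _)) ⟩
    plugDx (composeD D (esubP σ θ E)) ∎

-- Reduction

Step-plug : ∀ F {t u} → Step t u → Step (plug F t) (plug F u)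
Step-plug F (β G t v)
  rewrite sym (plug-compose F G (app (val (vlam t)) (val v))) | sym (plug-compose F G (t [ v ]₀)) =
  β (compose F G) t v
Step-plug F (shiftD G D t)
  rewrite sym (plug-compose F G (plugD D (shift t)))
        | sym (plug-compose F G (reset (t [ vlam (plugDx D) ]₀))) = shiftD (compose F G) D t
Step-plug F (resetV G v)
  rewrite sym (plug-compose F G (reset (val v))) | sym (plug-compose F G (val v)) = resetV (compose F G) v

-- A capture up to `α⟨E⟩` becomes a capture up to `θ(α)` composed with `E`, again a single delimited
-- context, so each step is mapped to exactly one step.
Step-esub : ∀ σ θ {t u} → Step t u → Step (esub σ θ t) (esub σ θ u)
Step-esub σ θ (β F t v)
  rewrite esub-plug σ θ F (app (val (vlam t)) (val v)) | esub-plug σ θ F (t [ v ]₀)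
        | esub-comm-[]₀ σ θ t v = β (esubC σ θ F) _ _
Step-esub σ θ (shiftD F D t)
  rewrite esub-plug σ θ F (plugD D (shift t)) | esub-plugD σ θ D (shift t)
        | esub-plug σ θ F (reset (t [ vlam (plugDx D) ]₀))
        | esub-comm-[]₀ σ θ t (vlam (plugDx D)) | esub-plugDx σ θ D = shiftD (esubC σ θ F) (esubD σ θ D) _
Step-esub σ θ (resetV F v)
  rewrite esub-plug σ θ F (reset (val v)) | esub-plug σ θ F (val v) = resetV (esubC σ θ F) _

data View : Tm → Set where
  value    : ∀ v → View (val v)
  steps    : ∀ {t u} → Step t u → View t
  open-nf  : ∀ F y v → View (plug F (app (val (vvar y)) (val v)))
  ctx-nf   : ∀ F α v → View (plug F (creset α (val v)))
  ctrl-nf  : ∀ E t → View (plugP E (shift t))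

-- A control-stuck subterm becomes a redex at the first delimiter of either sort. The two sorts
-- differ on values: `⟨v⟩` reduces, whereas `α⟨v⟩` is context-stuck.
view : ∀ t → View t
view (val v)   = value v
view (shift t) = ctrl-nf hole t
view (app t u) with view t
... | steps s       = steps (Step-plug (appL hole u) s)
... | open-nf F y v = open-nf (appL F u) y v
... | ctx-nf F α v  = ctx-nf (appL F u) α v
... | ctrl-nf E s   = ctrl-nf (appL E u) s
... | value w with view u
...   | steps s       = steps (Step-plug (appR w hole) s)
...   | open-nf F y v = open-nf (appR w F) y v
...   | ctx-nf F α v  = ctx-nf (appR w F) α v
...   | ctrl-nf E s   = ctrl-nf (appR w E) s
...   | value v with w
...     | vvar y = open-nf hole y v
...     | vlam t = steps (β hole t v)
view (reset t) with view t
... | value v       = steps (resetV hole v)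
... | steps s       = steps (Step-plug (reset hole) s)
... | open-nf F y v = open-nf (reset F) y v
... | ctx-nf F α v  = ctx-nf (reset F) α v
... | ctrl-nf E s   = steps (shiftD hole (dreset E) s)
view (creset α t) with view t
... | value v       = ctx-nf hole α v
... | steps s       = steps (Step-plug (creset α hole) s)
... | open-nf F y v = open-nf (creset α F) y v
... | ctx-nf F γ v  = ctx-nf (creset α F) γ v
... | ctrl-nf E s   = steps (shiftD hole (dcreset α E) s)

-- Reduction as a function; determinism and normality of values and of
-- control-stuck terms are read off from it.

data Outcome : Set where
  done  : Val → Outcome
  ctrl  : PCtx → Tm → Outcome
  next  : Tm → Outcome
  stuck : Outcome

mapO : (Tm → Tm) → (PCtx → PCtx) → Outcome → Outcome
mapO f g (done v)   = stuck
mapO f g (ctrl E t) = ctrl (g E) t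
mapO f g (next t)   = next (f t)
mapO f g stuck      = stuck

delimitO : (PCtx → DCtx) → (Val → Outcome) → (Tm → Tm) → Outcome → Outcome
delimitO d r f (done v)   = r v
delimitO d r f (ctrl E t) = next (reset (t [ vlam (plugDx (d E)) ]₀))
delimitO d r f (next t)   = next (f t)
delimitO d r f stuck      = stuck

applyO : Val → Val → Outcome
applyO (vvar y) v = stuck
applyO (vlam t) v = next (t [ v ]₀)

argO : Val → Outcome → Outcome
argO w (done v) = applyO w v
argO w o        = mapO (app (val w)) (appR w) o

funO : Tm → Outcome → Outcome → Outcome
funO u (done w) o = argO w o
funO u o₀       o = mapO (λ t → app t u) (λ E → appL E u) o₀

step : Tm → Outcome
step (val v)      = done v
step (shift t)    = ctrl hole t
step (app t u)    = funO u (step t) (step u)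
step (reset t)    = delimitO dreset (λ v → next (val v)) reset (step t)
step (creset α t) = delimitO (dcreset α) (λ _ → stuck) (creset α) (step t)

step-plugP : ∀ E t → step (plugP E (shift t)) ≡ ctrl E t
step-plugP hole       t = refl
step-plugP (appR v E) t rewrite step-plugP E t = refl
step-plugP (appL E u) t rewrite step-plugP E t = refl

step-plugD : ∀ D t → step (plugD D (shift t)) ≡ next (reset (t [ vlam (plugDx D) ]₀))
step-plugD (dreset E)    t rewrite step-plugP E t = refl
step-plugD (dcreset α E) t rewrite step-plugP E t = refl

step-plug : ∀ F {t u} → step t ≡ next u → step (plug F t) ≡ next (plug F u)
step-plug hole         h = h
step-plug (appR v F)   {t} {u} h rewrite step-plug F {t} {u} h = refl
step-plug (appL F w)   {t} {u} h rewrite step-plug F {t} {u} h = refl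
step-plug (reset F)    {t} {u} h rewrite step-plug F {t} {u} h = refl
step-plug (creset α F) {t} {u} h rewrite step-plug F {t} {u} h = refl

Step⇒step : ∀ {t u} → Step t u → step t ≡ next u
Step⇒step (β F t v)      = step-plug F refl
Step⇒step (shiftD F D t) = step-plug F (step-plugD D t)
Step⇒step (resetV F v)   = step-plug F refl

next-injective : ∀ {t u} → next t ≡ next u → t ≡ u
next-injective refl = refl

Step-deterministic : ∀ {t u w} → Step t u → Step t w → u ≡ w
Step-deterministic r s = next-injective (trans (sym (Step⇒step r)) (Step⇒step s))

val-normal : ∀ {v t} → ¬ Step (val v) t
val-normal s with () ← Step⇒step s

ctrl-normal : ∀ {E t u} → ¬ Step (plugP E (shift t)) u
ctrl-normal {E} {t} s with () ← trans (sym (step-plugP E t)) (Step⇒step s)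

-- Results and counted evaluation.

data Kind : Set where
  value control : Kind

Out : Kind → Tm → Set
Out value   u = Σ Val λ v → u ≡ val v
Out control u = ControlStuck u

Out-normal : ∀ k {t u} → Out k t → ¬ Step t u
Out-normal value   (v , refl)     = val-normal
Out-normal control (E , s , refl) = ctrl-normal {E}

data Steps : ℕ → Tm → Tm → Set where
  ε   : ∀ {t} → Steps 0 t t
  _◅_ : ∀ {n t u w} → Step t u → Steps n u w → Steps (suc n) t w

-- Used for the left program, whose exact step count drives the induction; the right program is only
-- asked for `Ends`.
Yields : Kind → ℕ → Tm → Set
Yields k n t = Σ Tm λ u → Steps n t u × Out k u

Ends : Kind → Tm → Set
Ends k t = Σ Tm λ u → Star Step t u × Out k u

yields : ∀ {k t} → Ends k t → Σ ℕ λ n → Yields k n t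
yields (u , ε , o) = 0 , u , ε , o
yields (u , s ◅ ss , o) with n , w , ts , o' ← yields (u , ss , o) = suc n , w , s ◅ ts , o'

-- By determinism the given step must be the first one of the counted run, and results are normal,
-- so the run cannot be empty.
advance : ∀ {k n t u} → Yields k n t → Step t u → Σ ℕ λ m → n ≡ suc m × Yields k m u
advance {k} (w , ε , o) s = ⊥-elim (Out-normal k o s)
advance (w , r ◅ rs , o) s rewrite Step-deterministic s r = _ , refl , w , rs , o

prepend : ∀ {k t u} → Star Step t u → Ends k u → Ends k t
prepend ss (w , rs , o) = w , ss ◅◅ rs , o

Star-esub : ∀ σ θ {t u} → Star Step t u → Star Step (esub σ θ t) (esub σ θ u)
Star-esub σ θ = gmap (esub σ θ) (Step-esub σ θ)

-- Delimited terms and a size for context-stuck terms.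

Delim : Tm → Set
Delim (val v)      = ⊤
Delim (app t u)    = ⊥
Delim (shift t)    = ⊥
Delim (reset t)    = ⊤
Delim (creset α t) = ⊤

Delim-plugD : ∀ D t → Delim (plugD D t)
Delim-plugD (dreset E)    t = tt
Delim-plugD (dcreset α E) t = tt

-- A step inside a delimiter keeps it, a capture at the root leaves a `reset`, and `⟨v⟩` leaves a
-- value; values count as delimited for this last reason.
Delim-step : ∀ {t u} → Step t u → Delim t → Delim u
Delim-step (β (reset F) t v)       d = tt
Delim-step (β (creset α F) t v)    d = tt
Delim-step (shiftD hole D t)       d = tt
Delim-step (shiftD (reset F) D t)  d = tt
Delim-step (shiftD (creset α F) D t) d = tt
Delim-step (resetV hole v)         d = tt
Delim-step (resetV (reset F) v)    d = tt
Delim-step (resetV (creset α F) v) d = tt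

Delim-plugx : ∀ F {t} → Delim (plug F t) → Delim (plugx F)
Delim-plugx hole         d = tt
Delim-plugx (reset F)    d = tt
Delim-plugx (creset α F) d = tt

-- Counts the context-variable delimiters that lie outside abstractions and `shift` bodies. It drops
-- when the `α⟨v⟩` in `F[α⟨v⟩]` is replaced by a variable.
csize : Tm → ℕ
csize (val v)      = 0
csize (app t u)    = csize t + csize u
csize (shift t)    = 0
csize (reset t)    = csize t
csize (creset α t) = suc (csize t)

csize-ren : ∀ ρ t → csize (ren ρ t) ≡ csize t
csize-ren ρ (val v)      = refl
csize-ren ρ (app t u)    = cong₂ _+_ (csize-ren ρ t) (csize-ren ρ u)
csize-ren ρ (shift t)    = refl
csize-ren ρ (reset t)    = csize-ren ρ t
csize-ren ρ (creset α t) = cong suc (csize-ren ρ t)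

csize-plugx : ∀ F α v → csize (plugx F) < csize (plug F (creset α (val v)))
csize-plugx hole         α v = z<s
csize-plugx (appR w F)   α v = csize-plugx F α v
csize-plugx (appL F u)   α v rewrite csize-ren suc u = +-monoˡ-< (csize u) (csize-plugx F α v)
csize-plugx (reset F)    α v = csize-plugx F α v
csize-plugx (creset _ F) α v = s<s (csize-plugx F α v)

Guard : Bool → Tm → Set
Guard false t = ⊤
Guard true  t = Delim t

guard : ∀ b {t} → Delim t → Guard b t
guard false d = tt
guard true  d = d

Guard-map : ∀ b {t u} → (Delim t → Delim u) → Guard b t → Guard b u
Guard-map false f g = tt
Guard-map true  f g = f g

Delim-ren : ∀ ρ t → Delim (ren ρ t) → Delim t
Delim-ren ρ (val v)      d = tt
Delim-ren ρ (reset t)    d = tt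
Delim-ren ρ (creset α t) d = tt

-- Unique decompositions and shapes of stuck terms.

-- The part of a context outside its innermost delimiter: decompositions
-- F[D] are unique because it recovers F.
outer : Ctx → Maybe Ctx
outer hole         = nothing
outer (appR v F)   = Maybe.map (appR v) (outer F)
outer (appL F u)   = Maybe.map (λ F → appL F u) (outer F)
outer (reset F)    = maybe (λ G → just (reset G)) (just hole) (outer F)
outer (creset α F) = maybe (λ G → just (creset α G)) (just hole) (outer F)

outer-embP : ∀ E → outer (embP E) ≡ nothing
outer-embP hole       = refl
outer-embP (appR v E) = cong (Maybe.map (appR v)) (outer-embP E)
outer-embP (appL E u) = cong (Maybe.map (λ F → appL F u)) (outer-embP E)

outer-compose : ∀ F D → outer (compose F (embD D)) ≡ just F
outer-compose hole (dreset E)    rewrite outer-embP E = refl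
outer-compose hole (dcreset α E) rewrite outer-embP E = refl
outer-compose (appR v F)   D rewrite outer-compose F D = refl
outer-compose (appL F u)   D rewrite outer-compose F D = refl
outer-compose (reset F)    D rewrite outer-compose F D = refl
outer-compose (creset α F) D rewrite outer-compose F D = refl

-- These contexts contain a delimiter, so the pure alternative of `RC` is impossible; in the other
-- one, `outer` forces the outer components to be `F₀` and `F₁`.
RC-reset : ∀ {R : Rel} F₀ F₁ → RC R (compose F₀ (reset hole)) (compose F₁ (reset hole)) →
           R (plugx F₀) (plugx F₁)
RC-reset F₀ F₁ (inj₁ (E₀ , _ , eq , _))
  with () ← trans (sym (outer-compose F₀ (dreset hole))) (trans (cong outer eq) (outer-embP E₀))
RC-reset F₀ F₁ (inj₂ (G₀ , D₀ , G₁ , D₁ , eq₀ , eq₁ , _ , r))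
  with refl ← trans (sym (outer-compose F₀ (dreset hole))) (trans (cong outer eq₀) (outer-compose G₀ D₀))
     | refl ← trans (sym (outer-compose F₁ (dreset hole))) (trans (cong outer eq₁) (outer-compose G₁ D₁)) = r

¬val-plug-app : ∀ F {v t u} → ¬ val v ≡ plug F (app t u)
¬val-plug-app hole         ()
¬val-plug-app (appR _ F)   ()
¬val-plug-app (appL F _)   ()
¬val-plug-app (reset F)    ()
¬val-plug-app (creset _ F) ()

app-inj : ∀ {t t' u u'} → app t u ≡ app t' u' → t ≡ t' × u ≡ u'
app-inj refl = refl , refl

open-head : ∀ F {y z v w} →
  app (val (vvar y)) (val v) ≡ plug F (app (val (vvar z)) (val w)) → y ≡ z
open-head hole       refl = refl
open-head (appR _ F) eq   = ⊥-elim (¬val-plug-app F (proj₂ (app-inj eq)))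
open-head (appL F _) eq   = ⊥-elim (¬val-plug-app F (proj₁ (app-inj eq)))

¬open-ctrl : ∀ E {y v t} → ¬ app (val (vvar y)) (val v) ≡ plugP E (shift t)
¬open-ctrl (appR _ hole) ()
¬open-ctrl (appL hole _) ()

-- A pure context around an application is never delimited, so such a term can only be run on a
-- stack of index `false`, where pure frames may be pushed.
Guard-pure : ∀ b E {t u} → Guard b (plugP E (app t u)) → b ≡ false
Guard-pure false E g = refl
Guard-pure true hole ()
Guard-pure true (appR v E) ()
Guard-pure true (appL E u) ()

Guard-ctrl : ∀ b E {t} → Guard b (plugP E (shift t)) → b ≡ false
Guard-ctrl false E g = refl
Guard-ctrl true hole ()
Guard-ctrl true (appR v E) ()
Guard-ctrl true (appL E u) ()

-- Related terms, environments and stacks, and their simulation.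

module Simulation (R : Rel) (prog : ∀ t₀ t₁ → R t₀ t₁ → Progress R t₀ t₁) where

  -- The renaming in base lets R-related open terms occur
  -- under binders.
  data CR : Tm → Tm → Set where
    base  : ∀ {t t'} ρ → R t t' → CR (ren ρ t) (ren ρ t')
    var   : ∀ n → CR (val (vvar n)) (val (vvar n))
    lam   : ∀ {t t'} → CR t t' → CR (val (vlam t)) (val (vlam t'))
    app   : ∀ {t t' u u'} → CR t t' → CR u u' → CR (app t u) (app t' u')
    shift : ∀ {t t'} → CR t t' → CR (shift t) (shift t')
    reset : ∀ {t t'} → CR t t' → CR (reset t) (reset t')

  mutual
    VEnv : (ℕ → Val) → (ℕ → Val) → Set
    VEnv σ σ' = ∀ n → V (σ n) (σ' n)

    DEnv : (ℕ → DCtx) → (ℕ → DCtx) → Set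
    DEnv θ θ' = ∀ α → DS (θ α) (θ' α)

    -- The sources of values are captured continuations, closures of `CR`-related bodies, and
    -- instances of `RV`-related values. Environments are stored inside the derivations, so looking
    -- up an entry yields a smaller derivation on which recursion is allowed.
    data V : Val → Val → Set where
      cont : ∀ {D D'} → DS D D' → V (vlam (plugDx D)) (vlam (plugDx D'))
      lam  : ∀ {t t' σ σ' θ θ'} → CR t t' → VEnv σ σ' → DEnv θ θ' →
             V (esubV σ θ (vlam t)) (esubV σ' θ' (vlam t'))
      base : ∀ {u u' σ σ' θ θ'} → RV R u u' → VEnv σ σ' → DEnv θ θ' →
             V (esubV σ θ u) (esubV σ' θ' u')

    data PF : PCtx → PCtx → Set where
      arg  : ∀ {v v'} → V v v' → PF (appR v hole) (appR v' hole)
      fun  : ∀ {u u' σ σ' θ θ'} → CR u u' → VEnv σ σ' → DEnv θ θ' →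
             PF (appL hole (esub σ θ u)) (appL hole (esub σ' θ' u'))
      base : ∀ {P P' σ σ' θ θ'} → R (plugPx P) (plugPx P') → VEnv σ σ' → DEnv θ θ' →
             PF (esubP σ θ P) (esubP σ' θ' P')

    data DS : DCtx → DCtx → Set where
      reset : DS (dreset hole) (dreset hole)
      base  : ∀ {D D' σ σ' θ θ'} → R (plugDx D) (plugDx D') → VEnv σ σ' → DEnv θ θ' →
              DS (esubD σ θ D) (esubD σ' θ' D')
      push  : ∀ {D D' P P'} → DS D D' → PF P P' → DS (composeD D P) (composeD D' P')

  -- Evaluation contexts as plugging functions.  The frame gen comes from
  -- F₀[D₀] Rᶜ F₁[D₁], where F₀ and F₁ need not have matching delimiters, so
  -- only a delimited term (index true) may be run inside it.
  data FS : Bool → (Tm → Tm) → (Tm → Tm) → Set where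
    nil  : FS false (λ t → t) (λ t → t)
    pure : ∀ {K K' P P'} → FS false K K' → PF P P' →
           FS false (λ t → K (plugP P t)) (λ t → K' (plugP P' t))
    del  : ∀ {b K K' D D'} → FS b K K' → DS D D' →
           FS false (λ t → K (plugD D t)) (λ t → K' (plugD D' t))
    gen  : ∀ {b K K' F F' σ σ' θ θ'} → FS b K K' → Guard b (plugx F) →
           R (plugx F) (plugx F') → VEnv σ σ' → DEnv θ θ' →
           FS true (λ t → K (plug (esubC σ θ F) t)) (λ t → K' (plug (esubC σ' θ' F') t))

  Step-plugP : ∀ P {t u} → Step t u → Step (plugP P t) (plugP P u)
  Step-plugP P {t} {u} s rewrite sym (plug-embP P t) | sym (plug-embP P u) = Step-plug (embP P) s

  Step-plugD : ∀ D {t u} → Step t u → Step (plugD D t) (plugD D u)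
  Step-plugD D {t} {u} s rewrite sym (plug-embD D t) | sym (plug-embD D u) = Step-plug (embD D) s

  Step-left : ∀ {b K K' t u} → FS b K K' → Step t u → Step (K t) (K u)
  Step-left nil s = s
  Step-left (pure {P = P} fs _) s = Step-left fs (Step-plugP P s)
  Step-left (del {D = D} fs _) s = Step-left fs (Step-plugD D s)
  Step-left (gen {F = F} {σ = σ} {θ = θ} fs _ _ _ _) s = Step-left fs (Step-plug (esubC σ θ F) s)

  Step-right : ∀ {b K K' t u} → FS b K K' → Step t u → Step (K' t) (K' u)
  Step-right nil s = s
  Step-right (pure {P' = P} fs _) s = Step-right fs (Step-plugP P s)
  Step-right (del {D' = D} fs _) s = Step-right fs (Step-plugD D s)
  Step-right (gen {F' = F} {σ' = σ} {θ' = θ} fs _ _ _ _) s = Step-right fs (Step-plug (esubC σ θ F) s)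

  Star-right : ∀ {b K K' t u} → FS b K K' → Star Step t u → Star Step (K' t) (K' u)
  Star-right {K' = K'} fs = gmap K' (Step-right fs)

  data Split (K K' : Tm → Tm) : Set where
    pure  : ∀ E E' → (∀ t → K t ≡ plugP E t) → (∀ t → K' t ≡ plugP E' t) → Split K K'
    delim : ∀ {b K₁ K₁' D D'} → FS b K₁ K₁' → DS D D' →
            (∀ t → K t ≡ K₁ (plugD D t)) → (∀ t → K' t ≡ K₁' (plugD D' t)) → Split K K'

  -- A stack of index `false` consists of paired pure frames down to either `nil` or a paired
  -- delimiter `del`. Hence both sides capture up to matching delimiters, or neither side has one.
  split : ∀ {K K'} → FS false K K' → Split K K'
  split nil = pure hole hole (λ _ → refl) (λ _ → refl)
  split (del fs ds) = delim fs ds (λ _ → refl) (λ _ → refl)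
  split (pure {P = P} {P'} fs pf) with split fs
  ... | pure E E' h h' = pure (composeP E P) (composeP E' P')
          (λ t → trans (h _) (sym (plugP-compose E P t)))
          (λ t → trans (h' _) (sym (plugP-compose E' P' t)))
  ... | delim {K₁ = K₁} {K₁'} {D} {D'} fs₁ ds h h' = delim fs₁ (push ds pf)
          (λ t → trans (h _) (cong K₁ (sym (plugD-compose D P t))))
          (λ t → trans (h' _) (cong K₁' (sym (plugD-compose D' P' t))))

  _•ᵛ_ : ∀ {v v' σ σ'} → V v v' → VEnv σ σ' → VEnv (v • σ) (v' • σ')
  (v •ᵛ ve) zero    = v
  (v •ᵛ ve) (suc n) = ve n

  _•ᵈ_ : ∀ {D D' θ θ'} → DS D D' → DEnv θ θ' → DEnv (D • θ) (D' • θ')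
  (d •ᵈ de) zero    = d
  (d •ᵈ de) (suc n) = de n

  Sim : Kind → ℕ → Set
  Sim k n = ∀ {b K K' t t' σ σ' θ θ'} → FS b K K' → CR t t' → VEnv σ σ' → DEnv θ θ' → Guard b t →
            Yields k n (K (esub σ θ t)) → Ends k (K' (esub σ' θ' t'))

  -- The number n of remaining steps of the left-hand
  -- term is fixed; every actual reduction step appeals to ih.
  module Level (k : Kind) (n : ℕ) (ih : ∀ m → n ≡ suc m → Sim k m) where

    -- A genuine left step pays for an appeal to `ih`, so the new configuration may be arbitrarily
    -- larger than the old one.
    later : ∀ {b K K' t t' σ σ' θ θ' u w} → FS b K K' → CR t t' → VEnv σ σ' → DEnv θ θ' → Guard b t →
            Yields k n u → Step u w → w ≡ K (esub σ θ t) → Ends k (K' (esub σ' θ' t'))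
    later fs c ve de g y s refl with m , eq , y' ← advance y s = ih m eq fs c ve de g y'

    laterR : ∀ {b K K' t t' σ σ' θ θ' u w} → FS b K K' → R t t' → VEnv σ σ' → DEnv θ θ' → Guard b t →
             Yields k n u → Step u w → w ≡ K (esub σ θ t) → Ends k (K' (esub σ' θ' t'))
    laterR {b} {K} {K'} {t} {t'} fs r ve de g y s eq =
      subst (λ t → Ends k (K' t)) (esub-ren (λ _ → refl) (λ _ → refl) t')
        (later fs (base (λ n → n) r) ve de (Guard-map b (ren-Delim t) g) y s
          (trans eq (cong K (sym (esub-ren (λ _ → refl) (λ _ → refl) t)))))
      where
      ren-Delim : ∀ {ρ} t → Delim t → Delim (ren ρ t)
      ren-Delim (val v)      d = tt
      ren-Delim (reset t)    d = tt
      ren-Delim (creset α t) d = tt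

    laterV : ∀ {b K K' v v' u w} → FS b K K' → V v v' →
             Yields k n u → Step u w → w ≡ K (val v) → Ends k (K' (val v'))
    -- The returned value is presented as variable 0 of an environment completed by `λx.⟨x⟩` and
    -- `⟨□⟩`.
    laterV {b} fs v y s eq = later fs (var 0) (v •ᵛ (λ _ → cont reset)) (λ _ → reset) (guard b tt) y s eq

    -- States at the current level `n` that returning a value to the stack is safe. Passing this as
    -- a hypothesis, rather than recomputing it from the stack, keeps the mutual recursion below
    -- structural.
    Good : (Tm → Tm) → (Tm → Tm) → Set
    Good K K' = ∀ {v v'} → V v v' → Yields k n (K (val v)) → Ends k (K' (val v'))

    Callable : Val → Val → Set
    Callable w w' = ∀ {K K' v v'} → FS false K K' → V v v' →
                    Yields k n (K (app (val w) (val v))) → Ends k (K' (app (val w') (val v')))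

    -- The value substituted for `z` takes control. A pure `F` becomes one pure frame; otherwise the
    -- outer part becomes a `gen` frame with the delimited part as a `del` above it, which restores
    -- index `false`.
    open-stuck : ∀ {b K K' F F' z v v' σ σ' θ θ'} → Callable (σ z) (σ' z) →
      RC R F F' → RV R v v' → FS b K K' → VEnv σ σ' → DEnv θ θ' →
      Guard b (plug F (app (val (vvar z)) (val v))) →
      Yields k n (K (esub σ θ (plug F (app (val (vvar z)) (val v))))) →
      Ends k (K' (esub σ' θ' (plug F' (app (val (vvar z)) (val v')))))
    open-stuck {b} {K} {K'} {z = z} {v} {v'} {σ} {σ'} {θ} {θ'} c (inj₁ (E , E' , refl , refl , r)) rv fs ve de g y
      with refl ← Guard-pure b E (subst (Guard b) (plug-embP E _) g) =
      subst (λ t → Ends k (K' t)) (sym (eq σ' θ' E' v'))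
        (c (pure fs (base r ve de)) (base rv ve de) (subst (λ t → Yields k n (K t)) (eq σ θ E v) y))
      where
      eq : ∀ σ θ E v → esub σ θ (plug (embP E) (app (val (vvar z)) (val v)))
                       ≡ plugP (esubP σ θ E) (app (val (σ z)) (val (esubV σ θ v)))
      eq σ θ E v = trans (cong (esub σ θ) (plug-embP E _)) (esub-plugP σ θ E _)
    open-stuck {b} {K} {K'} {z = z} {v} {v'} {σ} {σ'} {θ} {θ'} c
      (inj₂ (F , D , F' , D' , refl , refl , rD , rF)) rv fs ve de g y =
      subst (λ t → Ends k (K' t)) (sym (eq σ' θ' F' D' v'))
        (c (del (gen fs (Guard-map b (λ d → Delim-plugx F (subst Delim (plug-compose F _ _) d)) g) rF ve de)
                (base rD ve de))
           (base rv ve de) (subst (λ t → Yields k n (K t)) (eq σ θ F D v) y))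
      where
      eq : ∀ σ θ F D v → esub σ θ (plug (compose F (embD D)) (app (val (vvar z)) (val v)))
             ≡ plug (esubC σ θ F) (plugD (esubD σ θ D) (app (val (σ z)) (val (esubV σ θ v))))
      eq σ θ F D v = trans (cong (esub σ θ) (plug-composeD F D _))
        (trans (esub-plug σ θ F _) (cong (plug (esubC σ θ F)) (esub-plugD σ θ D _)))

    call : ∀ {w w'} → V w w' → Callable w w'
    call (cont {D} {D'} ds) {K} {K'} {v} {v'} fs a y =
      prepend (Step-right fs (β hole (plugDx D') v') ◅ ε)
        (subst (λ t → Ends k (K' t)) (sym (plugDx-[]₀ D' v'))
          (laterV (del fs ds) a y (Step-left fs (β hole (plugDx D) v)) (cong K (plugDx-[]₀ D v))))
    call (lam {t} {t'} {σ} {σ'} {θ} {θ'} c ve de) {K} {K'} {v} {v'} fs a y =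
      prepend (Step-right fs (β hole _ v') ◅ ε)
        (subst (λ t → Ends k (K' t)) (sym (esub-[]₀ σ' θ' t' v'))
          (later fs c (a •ᵛ ve) de tt y (Step-left fs (β hole _ v)) (cong K (esub-[]₀ σ θ t v))))
    -- The test term `u x` makes a β-step; the bisimulation answers it, and `x` is then instantiated
    -- by the argument.
    call (base {vlam t} {u'} {σ} {σ'} {θ} {θ'} r ve de) {K} {K'} {v} {v'} fs a y
      with t₁ , ss , r' ← proj₁ (prog _ _ r) _ (β hole (ren (ext suc) t) (vvar 0)) =
      subst (λ t → Ends k (K' t)) (esub-x-V σ' θ' u' v')
        (prepend (Star-right fs (Star-esub (v' • σ') θ' ss))
          (laterR fs r' (a •ᵛ ve) de tt
            (subst (λ t → Yields k n (K t)) (sym (esub-x-V σ θ (vlam t) v)) y)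
            (Step-left fs (Step-esub (v • σ) θ (β hole (ren (ext suc) t) (vvar 0)))) refl))
    call (base {vvar z} {u'} {σ} {σ'} {θ} {θ'} r ve de) {K} {K'} {v} {v'} fs a y
      -- The head is `suc z` because `RV` weakens the function, and `v • σ` sends it to `σ z`. No
      -- step is spent here: the recursion is on the smaller derivation `ve z`.
      with proj₂ (proj₂ (proj₂ (prog _ _ r))) (inj₁ (hole , suc z , vvar 0 , refl))
    ... | t₁ , _ , inj₂ (E , _ , _ , _ , eq , _) = ⊥-elim (¬open-ctrl E eq)
    ... | t₁ , (ss , _) , inj₁ (F₀ , F₁ , z₁ , v₀ , v₁ , eq , refl , rc , rv)
      with refl ← open-head F₀ eq =
      subst (λ t → Ends k (K' t)) (esub-x-V σ' θ' u' v')
        (prepend (Star-right fs (Star-esub (v' • σ') θ' ss))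
          (open-stuck {σ = v • σ} {v' • σ'} {θ} {θ'} (λ fs a y → call (ve z) fs a y) rc rv fs (a •ᵛ ve) de tt
            (subst (λ t → Yields k n (K (esub (v • σ) θ t))) eq y)))

    -- A control-stuck term is normal, so its run is empty and the term is itself the result.
    ctrl-yields : ∀ E {t} → Yields k n (plugP E (shift t)) → k ≡ control
    ctrl-yields E (_ , s ◅ _ , _) = ⊥-elim (ctrl-normal {E} s)
    ctrl-yields E {t} (_ , ε , o) = go k o
      where
      go : ∀ k → Out k (plugP E (shift t)) → k ≡ control
      go control o = refl
      go value (v , eq) with () ← trans (sym (step-plugP E t)) (cong step eq)

    -- After `split`, either both programs are control-stuck as a whole, or each captures in one
    -- step and `κ` continues with the related captured contexts.
    ctrl-stuck : ∀ {K K' s s'} E E' → FS false K K' →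
      (∀ {b K₁ K₁' D D'} → FS b K₁ K₁' → DS D D' → ∀ {u} → Yields k n u →
        Step u (K₁ (reset (s [ vlam (plugDx (composeD D E)) ]₀))) →
        Ends k (K₁' (reset (s' [ vlam (plugDx (composeD D' E')) ]₀)))) →
      Yields k n (K (plugP E (shift s))) → Ends k (K' (plugP E' (shift s')))
    ctrl-stuck {K} {K'} {s} {s'} E E' fs κ y with split fs
    ... | pure P P' h h' = subst (Ends k) (sym (trans (h' _) (sym (plugP-compose P' E' _))))
            (ends (ctrl-yields (composeP P E)
                     (subst (Yields k n) (trans (h _) (sym (plugP-compose P E _))) y)))
      where
      ends : k ≡ control → Ends k (plugP (composeP P' E') (shift s'))
      ends refl = _ , ε , composeP P' E' , s' , refl
    ... | delim {K₁ = K₁} {K₁'} {D} {D'} fs₁ ds h h' =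
      subst (Ends k) (sym (trans (h' _) (cong K₁' (sym (plugD-compose D' E' _)))))
        (prepend (Step-right fs₁ (shiftD hole (composeD D' E') s') ◅ ε)
          (κ fs₁ ds (subst (Yields k n) (trans (h _) (cong K₁ (sym (plugD-compose D E _)))) y)
            (Step-left fs₁ (shiftD hole (composeD D E) s))))

    mutual
      -- Recursion on the frame: `arg` calls its function, `fun` starts its stored argument with the
      -- returned function as the next frame, and `base` runs the test term with its variable bound
      -- to the returned value.
      retPF : ∀ {P P' K K'} → PF P P' → FS false K K' → Good K K' →
              Good (λ t → K (plugP P t)) (λ t → K' (plugP P' t))
      retPF (arg w) fs good v y = call w fs v y
      retPF (fun c ve de) fs good v y = termCR c ve de (pure fs (arg v)) (λ w y → call v fs w y) tt y
      retPF {K = K} {K'} (base {P} {P'} {σ} {σ'} {θ} {θ'} r ve de) fs good {v} {v'} a y =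
        subst (λ t → Ends k (K' t)) (esub-x-P σ' θ' P' v')
          (termR de _ ≤-refl r fs good (a •ᵛ ve) tt
            (subst (λ t → Yields k n (K t)) (sym (esub-x-P σ θ P v)) y))

      retDS : ∀ {b D D' K K'} → DS D D' → FS b K K' → Good K K' →
              Good (λ t → K (plugD D t)) (λ t → K' (plugD D' t))
      retDS reset fs good {v} {v'} a y =
        prepend (Step-right fs (resetV hole v') ◅ ε) (laterV fs a y (Step-left fs (resetV hole v)) refl)
      retDS {b} {K = K} {K'} (base {D} {D'} {σ} {σ'} {θ} {θ'} r ve de) fs good {v} {v'} a y =
        subst (λ t → Ends k (K' t)) (esub-x-D σ' θ' D' v')
          (termR de _ ≤-refl r fs good (a •ᵛ ve) (guard b (Delim-plugD (renD suc D) x))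
            (subst (λ t → Yields k n (K t)) (sym (esub-x-D σ θ D v)) y))
      -- `P` is nearest the hole, so it receives the value first; returning from it means returning
      -- to `D`.
      retDS {K = K} {K'} (push {D} {D'} {P} {P'} ds pf) fs good {v} {v'} a y =
        subst (λ t → Ends k (K' t)) (sym (plugD-compose D' P' _))
          (retPF pf (del fs ds) (λ a y → retDS ds fs good a y) a
            (subst (λ t → Yields k n (K t)) (plugD-compose D P _) y))

      termCR : ∀ {b K K' t t' σ σ' θ θ'} → CR t t' → VEnv σ σ' → DEnv θ θ' → FS b K K' → Good K K' →
               Guard b t → Yields k n (K (esub σ θ t)) → Ends k (K' (esub σ' θ' t'))
      termCR {b} {K} {K'} (base {t} {t'} ρ r) ve de fs good g y =
        subst (λ t → Ends k (K' t)) (sym (esub-ren (λ _ → refl) (λ _ → refl) t'))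
          (termR de _ ≤-refl r fs good (λ n → ve (ρ n)) (Guard-map b (Delim-ren ρ t) g)
            (subst (λ t → Yields k n (K t)) (esub-ren (λ _ → refl) (λ _ → refl) t) y))
      termCR (var z) ve de fs good g y = good (ve z) y
      termCR (lam c) ve de fs good g y = good (lam c ve de) y
      -- Applications and `shift` terms are not delimited, so the guard excludes index `true` for
      -- them.
      termCR {false} (app c c₁) ve de fs good g y =
        termCR c ve de (pure fs (fun c₁ ve de))
          (λ v y → termCR c₁ ve de (pure fs (arg v)) (λ w y → call v fs w y) tt y) tt y
      termCR {false} {σ = σ} {σ'} {θ} {θ'} (shift {t} {t'} c) ve de fs good g y =
        ctrl-stuck hole hole fs
          -- The continuation variable enters the environment through `cont ds`, the captured
          -- delimited context.
          (λ {b} {K₁} {K₁'} {D} {D'} fs₁ ds y s →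
            subst (λ t → Ends k (K₁' (reset t))) (sym (eq σ' θ' D' t'))
              (later fs₁ (reset c) (cont ds •ᵛ ve) de (guard b tt) y s
                (cong (λ t → K₁ (reset t)) (eq σ θ D t)))) y
        where
        eq : ∀ σ θ D t → esub (exts σ) (extd θ) t [ vlam (plugDx (composeD D hole)) ]₀
                         ≡ esub (vlam (plugDx D) • σ) θ t
        eq σ θ D t rewrite composeD-hole D = esub-[]₀ σ θ t _
      termCR (reset c) ve de fs good g y =
        termCR c ve de (del fs reset) (λ v y → retDS reset fs good v y) tt y

      -- On F[α⟨v⟩], v is returned to the context of α, whose derivation is part of
      -- de; the remaining frame F has smaller csize, which j bounds.
      termR : ∀ {b K K' t t' σ σ' θ θ'} → DEnv θ θ' → ∀ j → csize t < j → R t t' → FS b K K' → Good K K' →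
              VEnv σ σ' → Guard b t → Yields k n (K (esub σ θ t)) → Ends k (K' (esub σ' θ' t'))
      termR {b} {K} {K'} {t} {t'} {σ} {σ'} {θ} {θ'} de (suc j) (s≤s lt) r fs good ve g y
        with prog _ _ r | view t
      -- The left step lowers the count, and the reducts are again related by `R`; a delimited focus
      -- stays delimited.
      ... | onStep , _ | steps s with t₁ , ss , r' ← onStep _ s =
        prepend (Star-right fs (Star-esub σ' θ' ss))
          (laterR fs r' ve de (Guard-map b (Delim-step s) g) y (Step-left fs (Step-esub σ θ s)) refl)
      ... | _ , onVal , _ | value v with v₁ , (ss , _) , rv ← onVal v refl =
        prepend (Star-right fs (Star-esub σ' θ' ss)) (good (base rv ve de) y)
      ... | _ , _ , onCtx , _ | ctx-nf F α v with F₁ , v₁ , (ss , _) , rc , rv ← onCtx F α v refl =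
        prepend (Star-right fs (Star-esub σ' θ' ss))
          (subst (λ t → Ends k (K' t)) (sym (esub-plug σ' θ' F₁ _))
            (retDS (de α) (gen fs g' rF ve de)
              (λ {v} {v'} a y → subst (λ t → Ends k (K' t)) (esub-x-C σ' θ' F₁ v')
                (termR de j (<-≤-trans (csize-plugx F α _) lt) rF fs good (a •ᵛ ve) g'
                  (subst (λ t → Yields k n (K t)) (sym (esub-x-C σ θ F v)) y)))
              (base rv ve de)
              (subst (λ t → Yields k n (K t)) (esub-plug σ θ F _) y)))
        where
        rF : R (plugx F) (plugx F₁)
        rF = RC-reset {R} F F₁ rc
        g' : Guard b (plugx F)
        g' = Guard-map b (Delim-plugx F) g
      ... | _ , _ , _ , onStuck | open-nf F z v = stuckR onStuck (inj₁ (F , z , v , refl)) fs ve de g y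
      ... | _ , _ , _ , onStuck | ctrl-nf E s   = stuckR onStuck (inj₂ (E , s , refl)) fs ve de g y

      stuckR : ∀ {b K K' t t' σ σ' θ θ'} →
        (OpenStuck t ⊎ ControlStuck t → Σ Tm λ t₁ → t' ⇓ t₁ × RNF R t t₁) →
        OpenStuck t ⊎ ControlStuck t → FS b K K' → VEnv σ σ' → DEnv θ θ' → Guard b t →
        Yields k n (K (esub σ θ t)) → Ends k (K' (esub σ' θ' t'))
      stuckR {σ' = σ'} {θ' = θ'} onStuck st fs ve de g y with onStuck st
      ... | _ , (ss , _) , inj₁ (F₀ , F₁ , z , v₀ , v₁ , refl , refl , rc , rv) =
        prepend (Star-right fs (Star-esub σ' θ' ss))
          (open-stuck (λ fs a y → call (ve z) fs a y) rc rv fs ve de g y)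
      stuckR {b} {K} {K'} {σ = σ} {σ'} {θ} {θ'} onStuck st fs ve de g y
          | _ , (ss , _) , inj₂ (E₀ , s₀ , E₁ , s₁ , refl , refl , r)
        -- A control-stuck term is not delimited, so the index is `false` and the stack can be
        -- split. The captured context then instantiates the fresh context variable, through
        -- `ds •ᵈ de`.
        with refl ← Guard-ctrl b E₀ g =
        prepend (Star-right fs (Star-esub σ' θ' ss))
          (subst (λ t → Ends k (K' t)) (sym (esub-plugP σ' θ' E₁ _))
            (ctrl-stuck (esubP σ θ E₀) (esubP σ' θ' E₁) fs
              (λ {b} {K₁} {K₁'} {D} {D'} fs₁ ds y s →
                subst (λ t → Ends k (K₁' (reset t))) (esub-kont σ' θ' D' E₁ s₁)
                  (laterR fs₁ r ve (ds •ᵈ de) (guard b tt) y s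
                    (cong (λ t → K₁ (reset t)) (sym (esub-kont σ θ D E₀ s₀)))))
              (subst (λ t → Yields k n (K t)) (esub-plugP σ θ E₀ _) y)))

    -- Recursion on the stack, using the return lemma of its innermost frame. On the empty stack the
    -- value is the final result, which is incompatible with kind `control`.
    goodFS : ∀ {b K K'} → FS b K K' → Good K K'
    goodFS nil v y = value-ends y
      where
      go : ∀ k {v v'} → Out k (val v) → Ends k (val v')
      go value o = _ , ε , _ , refl
      go control (E , t , eq) with () ← trans (cong step eq) (step-plugP E t)
      value-ends : ∀ {v v'} → Yields k n (val v) → Ends k (val v')
      value-ends (_ , s ◅ _ , _) = ⊥-elim (val-normal s)
      value-ends (_ , ε , o)     = go k o
    goodFS (pure fs pf) v y = retPF pf fs (goodFS fs) v y
    goodFS (del fs ds)  v y = retDS ds fs (goodFS fs) v y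
    goodFS (gen {K = K} {K'} {F} {F'} {σ} {σ'} {θ} {θ'} fs g r ve de) {v} {v'} a y =
      subst (λ t → Ends k (K' t)) (esub-x-C σ' θ' F' v')
        (termR de _ ≤-refl r fs (goodFS fs) (a •ᵛ ve) g
          (subst (λ t → Yields k n (K t)) (sym (esub-x-C σ θ F v)) y))

    simulate : Sim k n
    simulate fs c ve de g y = termCR c ve de fs (goodFS fs) g y

  sim : ∀ k n → Sim k n
  -- With no left steps remaining, any appeal to the induction hypothesis is absurd.
  sim k zero    = Level.simulate k zero (λ m ())
  sim k (suc n) = Level.simulate k (suc n) (λ { m refl → sim k n })

  CR-refl : ∀ t → Plain t → CR t t
  CR-refl (val (vvar n)) p       = var n
  CR-refl (val (vlam t)) p       = lam (CR-refl t p)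
  CR-refl (app t u)      (p , q) = app (CR-refl t p) (CR-refl u q)
  CR-refl (shift t)      p       = shift (CR-refl t p)
  CR-refl (reset t)      p       = reset (CR-refl t p)

-- Closed and plain terms

ext-fixes : ∀ {n ρ} → (∀ m → m < n → ρ m ≡ m) → ∀ m → m < suc n → ext ρ m ≡ m
ext-fixes h zero    lt = refl
ext-fixes h (suc m) lt = cong suc (h m (s<s⁻¹ lt))

exts-fixes : ∀ {n σ} → (∀ m → m < n → σ m ≡ vvar m) → ∀ m → m < suc n → exts σ m ≡ vvar m
exts-fixes h zero    lt = refl
exts-fixes h (suc m) lt = cong (renV suc) (h m (s<s⁻¹ lt))

mutual
  renV-closed : ∀ {n ρ} v → WSV n v → (∀ m → m < n → ρ m ≡ m) → renV ρ v ≡ v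
  renV-closed (vvar m) w h = cong vvar (h m w)
  renV-closed (vlam t) w h = cong vlam (ren-closed t w (ext-fixes h))

  ren-closed : ∀ {n ρ} t → WS n t → (∀ m → m < n → ρ m ≡ m) → ren ρ t ≡ t
  ren-closed (val v)      w       h = cong val (renV-closed v w h)
  ren-closed (app t u)    (w , z) h = cong₂ app (ren-closed t w h) (ren-closed u z h)
  ren-closed (shift t)    w       h = cong shift (ren-closed t w (ext-fixes h))
  ren-closed (reset t)    w       h = cong reset (ren-closed t w h)
  ren-closed (creset α t) w       h = cong (creset α) (ren-closed t w h)

mutual
  esubV-closed : ∀ {n σ θ} v → WSV n v → PlainV v → (∀ m → m < n → σ m ≡ vvar m) → esubV σ θ v ≡ v
  esubV-closed (vvar m) w p h = h m w
  esubV-closed (vlam t) w p h = cong vlam (esub-closed t w p (exts-fixes h))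

  esub-closed : ∀ {n σ θ} t → WS n t → Plain t → (∀ m → m < n → σ m ≡ vvar m) → esub σ θ t ≡ t
  esub-closed (val v)   w       p       h = cong val (esubV-closed v w p h)
  esub-closed (app t u) (w , z) (p , q) h = cong₂ app (esub-closed t w p h) (esub-closed u z q h)
  esub-closed (shift t) w       p       h = cong shift (esub-closed t w p (exts-fixes h))
  esub-closed (reset t) w       p       h = cong reset (esub-closed t w p h)

mutual
  esubV-plain : ∀ {σ θ} v → PlainV v → esubV σ θ v ≡ subV σ v
  esubV-plain (vvar n) p = refl
  esubV-plain (vlam t) p = cong vlam (esub-plain t p)

  esub-plain : ∀ {σ θ} t → Plain t → esub σ θ t ≡ sub σ t
  esub-plain (val v)   p       = cong val (esubV-plain v p)
  esub-plain (app t u) (p , q) = cong₂ app (esub-plain t p) (esub-plain u q)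
  esub-plain (shift t) p       = cong shift (esub-plain t p)
  esub-plain (reset t) p       = cong reset (esub-plain t p)

mutual
  PlainV-ren : ∀ ρ v → PlainV v → PlainV (renV ρ v)
  PlainV-ren ρ (vvar n) p = tt
  PlainV-ren ρ (vlam t) p = Plain-ren (ext ρ) t p

  Plain-ren : ∀ ρ t → Plain t → Plain (ren ρ t)
  Plain-ren ρ (val v)   p       = PlainV-ren ρ v p
  Plain-ren ρ (app t u) (p , q) = Plain-ren ρ t p , Plain-ren ρ u q
  Plain-ren ρ (shift t) p       = Plain-ren (ext ρ) t p
  Plain-ren ρ (reset t) p       = Plain-ren ρ t p

PlainV-exts : ∀ {σ} → (∀ n → PlainV (σ n)) → ∀ n → PlainV (exts σ n)
PlainV-exts h zero    = tt
PlainV-exts {σ} h (suc n) = PlainV-ren suc (σ n) (h n)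

mutual
  PlainV-sub : ∀ {σ} → (∀ n → PlainV (σ n)) → ∀ v → PlainV v → PlainV (subV σ v)
  PlainV-sub h (vvar n) p = h n
  PlainV-sub h (vlam t) p = Plain-sub (PlainV-exts h) t p

  Plain-sub : ∀ {σ} → (∀ n → PlainV (σ n)) → ∀ t → Plain t → Plain (sub σ t)
  Plain-sub h (val v)   p       = PlainV-sub h v p
  Plain-sub h (app t u) (p , q) = Plain-sub h t p , Plain-sub h u q
  Plain-sub h (shift t) p       = Plain-sub (PlainV-exts h) t p
  Plain-sub h (reset t) p       = Plain-sub h t p

Plain-[]₀ : ∀ t v → Plain t → PlainV v → Plain (t [ v ]₀)
Plain-[]₀ t v p q = Plain-sub (λ { zero → q ; (suc n) → tt }) t p

Plain-plugP : ∀ E t → Plain (plugP E t) → Plain t × Plain (plugPx E)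
Plain-plugP hole       t p = p , tt
Plain-plugP (appR v E) t (q , p) with r , s ← Plain-plugP E t p = r , PlainV-ren suc v q , s
Plain-plugP (appL E u) t (p , q) with r , s ← Plain-plugP E t p = r , s , Plain-ren suc u q

Plain-plug : ∀ F t → Plain (plug F t) → Plain t × (∀ u → Plain u → Plain (plug F u))
Plain-plug hole       t p       = p , λ u q → q
Plain-plug (appR v F) t (q , p) with r , s ← Plain-plug F t p = r , λ u z → q , s u z
Plain-plug (appL F w) t (p , q) with r , s ← Plain-plug F t p = r , λ u z → s u z , q
Plain-plug (reset F)  t p       = Plain-plug F t p

-- Agreement of plain and extended reduction on plain terms.

Step⇒PStep : ∀ {t u} → Plain t → Step t u → PStep t u × Plain u
Step⇒PStep p (β F t v) with (q , r) , f ← Plain-plug F _ p = β F t v , f _ (Plain-[]₀ t v q r)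
Step⇒PStep p (shiftD F (dreset E) t)
  with q , f ← Plain-plug F _ p
  with r , s ← Plain-plugP E (shift t) q = shiftR F E t , f _ (Plain-[]₀ t _ r s)
Step⇒PStep p (shiftD F (dcreset α E) t) = ⊥-elim (proj₁ (Plain-plug F _ p))
Step⇒PStep p (resetV F v) with q , f ← Plain-plug F _ p = resetV F v , f _ q

PStep⇒Step : ∀ {t u} → PStep t u → Step t u
PStep⇒Step (β F t v)      = β F t v
PStep⇒Step (shiftR F E t) = shiftD F (dreset E) t
PStep⇒Step (resetV F v)   = resetV F v

Star⇒PStar : ∀ {t u} → Plain t → Star Step t u → Star PStep t u
Star⇒PStar p ε = ε
Star⇒PStar p (s ◅ ss) with r , q ← Step⇒PStep p s = r ◅ Star⇒PStar q ss

Evals : Kind → Tm → Set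
Evals value   = EvalsToValue
Evals control = EvalsToStuck

Evals⇒Ends : ∀ k {t} → Evals k t → Ends k t
Evals⇒Ends value   (v , ss , _)       = val v , gmap (λ t → t) PStep⇒Step ss , v , refl
Evals⇒Ends control (u , (ss , _) , o) = u , gmap (λ t → t) PStep⇒Step ss , o

Ends⇒Evals : ∀ k {t} → Plain t → Ends k t → Evals k t
Ends⇒Evals value   p (_ , ss , v , refl) = v , Star⇒PStar p ss , λ _ s → val-normal (PStep⇒Step s)
Ends⇒Evals control p (u , ss , o) =
  u , (Star⇒PStar p ss , λ _ s → Out-normal control o (PStep⇒Step s)) , o

-- Closing contexts and contextual equivalence.

Plain-gplug : ∀ C {n t} → WSC n C → Plain t → Plain (gplug C t)
Plain-gplug ghole       w             p = p
Plain-gplug (glam C)    w             p = Plain-gplug C w p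
Plain-gplug (gappR u C) ((_ , q) , w) p = q , Plain-gplug C w p
Plain-gplug (gappL C u) (w , _ , q)   p = Plain-gplug C w p , q
Plain-gplug (gshift C)  w             p = Plain-gplug C w p
Plain-gplug (greset C)  w             p = Plain-gplug C w p

-- Capture-avoiding variant of gplug: ρ moves the free variables of the filler
-- past the binders of the context, so that C[tσ] = (fill id C t)σ for closed C.
fill : (ℕ → ℕ) → GCtx → Tm → Tm
fill ρ ghole       t = ren ρ t
fill ρ (glam C)    t = val (vlam (fill (λ n → suc (ρ n)) C t))
fill ρ (gappR u C) t = app u (fill ρ C t)
fill ρ (gappL C u) t = app (fill ρ C t) u
fill ρ (gshift C)  t = shift (fill (λ n → suc (ρ n)) C t)
fill ρ (greset C)  t = reset (fill ρ C t)

-- The invariant under binders: `σ` fixes the variables bound by the context, and `ρ` followed by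
-- `σ` instantiates the filler to `s`. Each binder weakens the latter by one, which leaves `s`
-- unchanged since `s` is stable under shifting.
esub-fill : ∀ C {n σ θ ρ t s} → WSC n C → (∀ m → m < n → σ m ≡ vvar m) → ren suc s ≡ s →
            esub (λ m → σ (ρ m)) θ t ≡ s → esub σ θ (fill ρ C t) ≡ gplug C s
esub-fill ghole {t = t} w h c eq = trans (esub-ren (λ _ → refl) (λ _ → refl) t) eq
esub-fill (glam C) {t = t} w h c eq = cong (λ t → val (vlam t)) (esub-fill C w (exts-fixes h) c
  (trans (sym (ren-esub (λ _ → refl) (λ _ → refl) t)) (trans (cong (ren suc) eq) c)))
esub-fill (gappR u C) ((z , p) , w) h c eq = cong₂ app (esub-closed u z p h) (esub-fill C w h c eq)
esub-fill (gappL C u) (w , z , p) h c eq = cong₂ app (esub-fill C w h c eq) (esub-closed u z p h)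
esub-fill (gshift C) {t = t} w h c eq = cong shift (esub-fill C w (exts-fixes h) c
  (trans (sym (ren-esub (λ _ → refl) (λ _ → refl) t)) (trans (cong (ren suc) eq) c)))
esub-fill (greset C) w h c eq = cong reset (esub-fill C w h c eq)

ren-suc-sub : ∀ {σ} t → (∀ n → WSV 0 (σ n)) → ren suc (sub σ t) ≡ sub σ t
ren-suc-sub {σ} t h = subst (λ s → ren suc s ≡ s) (sym (sub-esub σ t))
  (ren-esub (λ n → renV-closed (σ n) (h n) (λ _ ())) (λ _ → refl) t)

module _ (R : Rel) (prog : ∀ t₀ t₁ → R t₀ t₁ → Progress R t₀ t₁) where
  open Simulation R prog

  CR-fill : ∀ C {n ρ t t'} → WSC n C → R t t' → CR (fill ρ C t) (fill ρ C t')
  CR-fill ghole {ρ = ρ} w             r = base ρ r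
  CR-fill (glam C)      w             r = lam (CR-fill C w r)
  CR-fill (gappR u C)   ((_ , p) , w) r = app (CR-refl u p) (CR-fill C w r)
  CR-fill (gappL C u)   (w , _ , p)   r = app (CR-fill C w r) (CR-refl u p)
  CR-fill (gshift C)    w             r = shift (CR-fill C w r)
  CR-fill (greset C)    w             r = reset (CR-fill C w r)

  V-refl : ∀ v → WSV 0 v → PlainV v → V v v
  -- A closed plain value is its own instance under any environment, so `λx.⟨x⟩` and `⟨□⟩` serve as
  -- entries.
  V-refl (vlam t) w p = subst (λ v → V v v) (esubV-closed (vlam t) w p (λ _ ()))
    (lam {σ = λ _ → vlam (plugDx (dreset hole))} {θ = λ _ → dreset hole}
      (CR-refl t p) (λ _ → cont reset) (λ _ → reset))

  -- The closing substitution is kept as the environment of the simulation, so the open terms stay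
  -- related by `R` inside the context, and the run starts from the empty stack.
  preserves : ∀ {t₀ t₁} → R t₀ t₁ → Plain t₀ → Plain t₁ →
    ∀ σ → (∀ n → WSV 0 (σ n) × PlainV (σ n)) → ∀ C → ClosedCtx C →
    ∀ k → Evals k (gplug C (sub σ t₀)) → Evals k (gplug C (sub σ t₁))
  preserves {t₀} {t₁} r p₀ p₁ σ h C w k e =
    Ends⇒Evals k (Plain-gplug C w (Plain-sub (λ n → proj₂ (h n)) t₁ p₁))
      (subst (Ends k) (eq t₁ p₁)
        (sim k m nil (CR-fill C w r) (λ n → V-refl (σ n) (proj₁ (h n)) (proj₂ (h n)))
          (λ _ → reset) tt y))
    where
    eq : ∀ t → Plain t → esub σ (λ _ → dreset hole) (fill (λ n → n) C t) ≡ gplug C (sub σ t)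
    eq t p = esub-fill C w (λ _ ()) (ren-suc-sub t (λ n → proj₁ (h n))) (esub-plain t p)
    counted : Σ ℕ λ m → Yields k m (esub σ (λ _ → dreset hole) (fill (λ n → n) C t₀))
    counted = yields (subst (Ends k) (sym (eq t₀ p₀)) (Evals⇒Ends k e))
    m = proj₁ counted
    y = proj₂ counted

theorem6p19 : (t₀ t₁ : Tm) → Plain t₀ → Plain t₁ → t₀ ≈r t₁ →
    (t₀ ≅° t₁) × (Closed t₀ → Closed t₁ → t₀ ≅ t₁)
theorem6p19 t₀ t₁ p₀ p₁ (R , bisim , r) = open-equiv , closed-equiv
  where
  open-equiv : t₀ ≅° t₁
  open-equiv σ h C w = equiv value , equiv control
    where
    equiv : ∀ k → Evals k (gplug C (sub σ t₀)) ⇔ Evals k (gplug C (sub σ t₁))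
    equiv k = mk⇔
      (preserves R (λ u v r → proj₁ (bisim u v r)) r p₀ p₁ σ h C w k)
      -- The converse is the same simulation for the flipped relation, whose progress is the
      -- symmetric half of the bisimulation.
      (preserves (flip R) (λ u v r → proj₂ (bisim v u r)) r p₁ p₀ σ h C w k)

  -- Closed terms are fixed by every substitution; the identity function supplies the closed plain
  -- values that `≅°` asks for.
  ident : ℕ → Val
  ident _ = vlam x

  sub-ident : ∀ t → Closed t → Plain t → sub ident t ≡ t
  sub-ident t c p = trans (sub-esub ident t) (esub-closed t c p (λ _ ()))

  closed-equiv : Closed t₀ → Closed t₁ → t₀ ≅ t₁
  closed-equiv c₀ c₁ = subst₂ _≅_ (sub-ident t₀ c₀ p₀) (sub-ident t₁ c₁ p₁)
    (open-equiv ident (λ _ → s≤s z≤n , tt))
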